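{- Let $\mathcal{H}=(\mathcal{V},\mathcal{E})$ be a connected Sperner hypergraph with $|\mathcal{E}|\ge 2$. (i) If $F(\mathcal{H})\neq\emptyset$, then $(\lambda-1)^2$ divides $P(\mathcal{H},\lambda)$ if and only if $|F(\mathcal{H})|=1$. (ii) Suppose $F(\mathcal{H})=\emptyset$ and there are a vertex $w$ and two proper subsets $\mathcal{V}_1,\mathcal{V}_2$ of $\mathcal{V}$ with $\mathcal{V}_1\cup\mathcal{V}_2=\mathcal{V}$, $\mathcal{V}_1\cap\mathcal{V}_2=\{w\}$, such that every $e\in\mathcal{E}$ either contains $w$ or is contained in $\mathcal{V}_i$ for some $i\in\{1,2\}$. Then $(\lambda-1)^2$ divides $P(\mathcal{H},\lambda)$ if and only if one of the following holds: (a) $\mathcal{V}_i\notin\mathcal{I}(\mathcal{H})$ for both $i=1,2$; (b) for some $i\in\{1,2\}$, $\mathcal{V}_i\in\mathcal{I}(\mathcal{H})$, $\mathcal{V}_{3-i}\notin\mathcal{I}(\mathcal{H})$, and $(\lambda-1)^2$ divides $P(\mathcal{H}\cdot\mathcal{V}_i,\lambda)$.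
   Context: A hypergraph $\mathcal{H}=(\mathcal{V},\mathcal{E})$ has a finite vertex set $\mathcal{V}$ and a set $\mathcal{E}$ of subsets of $\mathcal{V}$ of size at least 1. For positive integer $\lambda$, a weak proper $\lambda$-colouring is a map $\phi:\mathcal{V}\to\{1,\dots,\lambda\}$ with $|\{\phi(v):v\in e\}|>1$ for every $e\in\mathcal{E}$; $P(\mathcal{H},\lambda)$ is the polynomial counting them. $\mathcal{H}$ is connected if any two vertices $v_1,v_2$ are joined by a sequence of edges $e_0,\dots,e_k$ with $v_1\in e_0$, $v_2\in e_k$, $e_i\cap e_{i+1}\ne\emptyset$. $\mathcal{H}$ is Sperner if no edge is contained in a different edge. $F(\mathcal{H})$ is the set of vertices lying in every edge. $\mathcal{I}(\mathcal{H})$ is the set of subsets $\mathcal{V}_0\subseteq\mathcal{V}$ containing no edge of $\mathcal{H}$. For $\mathcal{V}_0\subseteq\mathcal{V}$, $\mathcal{H}\cdot\mathcal{V}_0$ is obtained by identifying all vertices of $\mathcal{V}_0$ into one new vertex $w'$: its vertex set is $(\mathcal{V}\setminus\mathcal{V}_0)\cup\{w'\}$ and its edge set is $\{e\in\mathcal{E}:e\cap\mathcal{V}_0=\emptyset\}\cup\{(e\setminus\mathcal{V}_0)\cup\{w'\}:e\in\mathcal{E},\,e\cap\mathcal{V}_0\ne\emptyset\}$. -}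

module Defs where

open import Data.Nat as ℕ using (ℕ; zero; suc; _≤_)
open import Data.Integer as ℤ using (ℤ; +_; _-_)
open import Data.Fin using (Fin; zero; suc; _≟_)
open import Data.Fin.Properties using (any?; all?)
open import Data.Fin.Subset using (Subset; _∈_; _⊆_; Nonempty)
open import Data.Fin.Subset.Properties using (_∈?_)
open import Data.Bool using (true; false)
open import Data.Vec using (Vec; []; _∷_; tabulate)
open import Data.Maybe using (Maybe; just; nothing; maybe)
import Data.Maybe as Maybe
open import Data.List using (List; []; _∷_; [_]; length; filter; concatMap; map; allFin)
open import Data.Product using (∃; _×_; _,_)
open import Relation.Nullary using (¬_; Dec; yes; no; does)
open import Relation.Nullary.Decidable using (_×-dec_; ¬?)
open import Relation.Binary.PropositionalEquality using (_≡_; _≢_)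

-- Hypergraphs.  Vertex set = Fin n; edges given as an indexed family
-- E : Fin m → Subset n.  The edge SET of the hypergraph is the image of E.
-- (Hypotheses such as distinctness/Sperner are stated separately.)

Hypergraph : ℕ → ℕ → Set
Hypergraph n m = Fin m → Subset n

EdgesNonempty : ∀ {n m} → Hypergraph n m → Set
EdgesNonempty E = ∀ i → Nonempty (E i)

Sperner : ∀ {n m} → Hypergraph n m → Set
Sperner E = ∀ i j → E i ⊆ E j → i ≡ j

data Chain {n m} (E : Hypergraph n m) : Fin m → Fin m → Set where
  here : ∀ {i} → Chain E i i
  step : ∀ {i j k} → (∃ λ v → v ∈ E i × v ∈ E j) → Chain E j k → Chain E i k

Connected : ∀ {n m} → Hypergraph n m → Set
Connected {n} {m} E =
  ∀ (v₁ v₂ : Fin n) → ∃ λ (i : Fin m) → ∃ λ (j : Fin m) →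
    v₁ ∈ E i × v₂ ∈ E j × Chain E i j

F : ∀ {n m} → Hypergraph n m → Subset n
F E = tabulate (λ v → does (all? (λ i → v ∈? E i)))

Independent : ∀ {n m} → Hypergraph n m → Subset n → Set
Independent E V₀ = ¬ (∃ λ i → E i ⊆ V₀)

Proper : ∀ {n m x} → Hypergraph n m → (Fin n → Fin x) → Set
Proper E φ = ∀ i → ∃ λ u → ∃ λ v → u ∈ E i × v ∈ E i × φ u ≢ φ v

proper? : ∀ {n m x} (E : Hypergraph n m) (φ : Fin n → Fin x) → Dec (Proper E φ)
proper? E φ = all? (λ i → any? (λ u → any? (λ v →
  (u ∈? E i) ×-dec ((v ∈? E i) ×-dec ¬? (φ u ≟ φ v)))))

consF : ∀ {n x} → Fin x → (Fin n → Fin x) → Fin (suc n) → Fin x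
consF c f zero    = c
consF c f (suc i) = f i

allMaps : (n x : ℕ) → List (Fin n → Fin x)
allMaps zero    x = [ (λ ()) ]
allMaps (suc n) x = concatMap (λ c → map (consF c) (allMaps n x)) (allFin x)

P : ∀ {n m} → Hypergraph n m → ℕ → ℕ
P {n} E x = length (filter (proper? E) (allMaps n x))

Poly : Set
Poly = List ℤ

eval : Poly → ℤ → ℤ
eval []       t = + 0
eval (c ∷ cs) t = c ℤ.+ t ℤ.* eval cs t

-- (λ - 1)^2 divides the polynomial whose value at each positive integer
-- λ is f λ : there is q ∈ ℤ[λ] with f(λ) = (λ-1)^2 q(λ) for all λ ≥ 1.
-- (Polynomials agreeing on infinitely many points are equal.)
SqDivides : (ℕ → ℕ) → Set
SqDivides f = ∃ λ (q : Poly) → ∀ (x : ℕ) → 1 ≤ x →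
  + (f x) ≡ ((+ x - + 1) ℤ.* (+ x - + 1)) ℤ.* eval q (+ x)

-- Contraction H · V₀ : identify the vertices of V₀ into a new vertex w'.
-- New vertex set Fin (suc (keep V₀)): zero is w', suc j are the vertices
-- outside V₀ in their original order.

keep : ∀ {n} → Subset n → ℕ
keep []            = 0
keep (true  ∷ p)   = keep p
keep (false ∷ p)   = suc (keep p)

embed : ∀ {n} (p : Subset n) → Fin n → Maybe (Fin (keep p))
embed (true  ∷ p) zero    = nothing
embed (true  ∷ p) (suc v) = embed p v
embed (false ∷ p) zero    = just zero
embed (false ∷ p) (suc v) = Maybe.map suc (embed p v)

contractMap : ∀ {n} (p : Subset n) → Fin n → Fin (suc (keep p))
contractMap p v = maybe suc zero (embed p v)

image : ∀ {n k} → (Fin n → Fin k) → Subset n → Subset k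
image f e = tabulate (λ u → does (any? (λ v → (v ∈? e) ×-dec (f v ≟ u))))

-- H · V₀ : each edge e becomes e if e ∩ V₀ = ∅, and (e ∖ V₀) ∪ {w'} otherwise;
-- this is exactly the image of e under contractMap V₀.
contract : ∀ {n m} → Hypergraph n m → (V₀ : Subset n) → Hypergraph (suc (keep V₀)) m
contract E V₀ i = image (contractMap V₀) (E i)

{-# OPTIONS --safe #-}
module Submission where

open import Defs
open import Data.Nat using (ℕ; _≤_; zero; suc; s≤s; z≤n)
import Data.Nat as ℕ
import Data.Nat.Properties as ℕₚ
import Data.Nat.Divisibility as ℕ∣
open import Data.Integer as ℤ using (ℤ; +_; 0ℤ; 1ℤ; _+_; _*_; _-_; -_; _^_)
import Data.Integer.Properties as ℤₚ
open import Data.Integer.Tactic.RingSolver using (solve-∀)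
open import Algebra.Properties.Semiring.Sum ℤₚ.+-*-semiring
  using (sum; sum-cong-≗; ∑-distrib-+; *-distribˡ-sum; *-distribʳ-sum; ∑-comm)
open import Data.Bool using (true; false; if_then_else_)
open import Data.Fin using (Fin; zero; suc; _≟_; punchIn)
open import Data.Fin.Properties using (all?; any?; suc-injective)
open import Data.Fin.Subset using (Subset; _∈_; _∉_; _⊆_; _⊂_; _∪_; _∩_; ∁; ⁅_⁆; ⊤; ⊥; ∣_∣; Nonempty; Empty; inside; outside)
open import Data.Fin.Subset.Properties using (_∈?_; _⊆?_; ∈⊤; drop-there; x∈p∩q⁺; x∈p∩q⁻; x∈p∪q⁻; x∈p∪q⁺; x∈⁅x⁆; x∈⁅y⁆⇒x≡y; x∈∁p⇒x∉p; x∉p⇒x∈∁p; ⊆-antisym)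
open import Data.List as List using (List; []; _∷_; _++_; length; filter; concatMap; map; allFin)
import Data.List.Properties as Listₚ
open import Data.List.Membership.Propositional.Properties using (∈-allFin; ∈-filter⁺)
open import Data.List.Relation.Unary.All as All using (All; []; _∷_)
import Data.List.Relation.Unary.All.Properties as Allₚ
open import Data.Maybe using (just; nothing)
open import Data.Product using (_×_; _,_; ∃; proj₁; proj₂)
open import Data.Sum using (_⊎_; inj₁; inj₂)
open import Data.Vec using ([]; _∷_; here; there; tabulate)
open import Data.Vec.Properties using (lookup∘tabulate; lookup⇒[]=; []=⇒lookup)
open import Relation.Nullary using (¬_; Dec; yes; no; does; contradiction)
open import Relation.Nullary.Decidable using (_×-dec_; _→-dec_; ¬?; decidable-stable; dec-true; dec-false; does-⇔)
open import Relation.Unary using (Pred; Decidable)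
open import Relation.Binary.PropositionalEquality using (_≡_; _≢_; _≗_; refl; sym; trans; cong; cong₂; subst; module ≡-Reasoning)
open import Function using (_∘_; id)
open import Function.Bundles using (_⇔_; mk⇔)

open ≡-Reasoning

-- Modulo (x − 1)² a polynomial is b + a (x − 1), so the question is whether P′(1) = 0.
-- Colourings are counted after fixing the colour c of a vertex w.
--
-- (i) If w lies in every edge, inclusion–exclusion over the edges that are monochromatic
-- (hence of colour c) gives P′(1) = |F ∖ {w}|.
--
-- (ii) P′(1) = P(H·V₁)′(1) + P(H·V₂)′(1): the difference of the two sides counts the proper
-- colourings that are constant on neither V₁ nor V₂.  Once w is coloured, "e is
-- monochromatic" is a product of a condition on V₁ ∖ {w} and a condition on V₂, so this count
-- is a signed sum of products of two factors, each vanishing at x = 1.  If V_i contains an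
-- edge then P(H·V_i) = 0, and if neither does then w lies in every edge.

-- Arithmetic of integer polynomials.

_+ᵖ_ : Poly → Poly → Poly
[]      +ᵖ q       = q
(a ∷ p) +ᵖ []      = a ∷ p
(a ∷ p) +ᵖ (b ∷ q) = (a + b) ∷ (p +ᵖ q)

eval-+ᵖ : ∀ p q t → eval (p +ᵖ q) t ≡ eval p t + eval q t
eval-+ᵖ []      q       t = sym (ℤₚ.+-identityˡ _)
eval-+ᵖ (a ∷ p) []      t = sym (ℤₚ.+-identityʳ _)
eval-+ᵖ (a ∷ p) (b ∷ q) t = trans
  (cong (λ z → a + b + t * z) (eval-+ᵖ p q t)) (lemma a b t (eval p t) (eval q t))
  where
  lemma : ∀ a b t y z → a + b + t * (y + z) ≡ (a + t * y) + (b + t * z)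
  lemma = solve-∀

-ᵖ_ : Poly → Poly
-ᵖ p = map -_ p

eval--ᵖ : ∀ p t → eval (-ᵖ p) t ≡ - eval p t
eval--ᵖ []      t = refl
eval--ᵖ (a ∷ p) t = trans (cong (λ z → - a + t * z) (eval--ᵖ p t)) (lemma a t (eval p t))
  where
  lemma : ∀ a t y → - a + t * - y ≡ - (a + t * y)
  lemma = solve-∀

-- Expansions at x = 1 modulo (x - 1)².

-- T x c ≡ b + a (x − 1) modulo (x − 1)² ℤ[x].  The argument c : Fin x, a colour
-- on which the value does not depend, also encodes the condition x ≥ 1.
record Jet (T : ∀ x → Fin x → ℤ) (b a : ℤ) : Set where
  constructor jet
  field
    quotient  : Poly
    expansion : ∀ x (c : Fin x) →
      T x c ≡ b + a * (+ x - 1ℤ) + (+ x - 1ℤ) * (+ x - 1ℤ) * eval quotient (+ x)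

Jet-cong : ∀ {T T′ b a} → (∀ x c → T′ x c ≡ T x c) → Jet T b a → Jet T′ b a
Jet-cong eq (jet q h) = jet q λ x c → trans (eq x c) (h x c)

Jet-coeff : ∀ {T b b′ a a′} → b ≡ b′ → a ≡ a′ → Jet T b a → Jet T b′ a′
Jet-coeff refl refl j = j

Jet-+ : ∀ {T T′ b b′ a a′} → Jet T b a → Jet T′ b′ a′ →
        Jet (λ x c → T x c + T′ x c) (b + b′) (a + a′)
Jet-+ {b = b} {b′} {a} {a′} (jet q h) (jet q′ h′) = jet (q +ᵖ q′) λ x c → trans
  (cong₂ _+_ (h x c) (h′ x c))
  (trans (lemma b b′ a a′ (+ x - 1ℤ) (eval q (+ x)) (eval q′ (+ x)))
         (cong (λ z → b + b′ + (a + a′) * (+ x - 1ℤ) + (+ x - 1ℤ) * (+ x - 1ℤ) * z)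
               (sym (eval-+ᵖ q q′ (+ x)))))
  where
  lemma : ∀ b b′ a a′ m y z →
    (b + a * m + m * m * y) + (b′ + a′ * m + m * m * z) ≡ b + b′ + (a + a′) * m + m * m * (y + z)
  lemma = solve-∀

Jet-neg : ∀ {T b a} → Jet T b a → Jet (λ x c → - T x c) (- b) (- a)
Jet-neg {b = b} {a} (jet q h) = jet (-ᵖ q) λ x c → trans (cong -_ (h x c))
  (trans (lemma b a (+ x - 1ℤ) (eval q (+ x)))
         (cong (λ z → - b + - a * (+ x - 1ℤ) + (+ x - 1ℤ) * (+ x - 1ℤ) * z)
               (sym (eval--ᵖ q (+ x)))))
  where
  lemma : ∀ b a m y → - (b + a * m + m * m * y) ≡ - b + - a * m + m * m * - y
  lemma = solve-∀

Jet-- : ∀ {T T′ b b′ a a′} → Jet T b a → Jet T′ b′ a′ →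
        Jet (λ x c → T x c - T′ x c) (b - b′) (a - a′)
Jet-- j j′ = Jet-+ j (Jet-neg j′)

-- With x = 1 + (x - 1), the product x · a (x - 1) leaves over a (x - 1)², so a becomes the constant
-- coefficient of the new quotient.
Jet-x* : ∀ {T b a} → Jet T b a → Jet (λ x c → + x * T x c) b (a + b)
Jet-x* {b = b} {a} (jet q h) = jet (a ∷ q) λ x c →
  trans (cong (+ x *_) (h x c)) (lemma b a (+ x) (eval q (+ x)))
  where
  lemma : ∀ b a t y → t * (b + a * (t - 1ℤ) + (t - 1ℤ) * (t - 1ℤ) * y) ≡
          b + (a + b) * (t - 1ℤ) + (t - 1ℤ) * (t - 1ℤ) * (a + t * y)
  lemma = solve-∀

Jet-^ : ∀ k → Jet (λ x _ → (+ x) ^ k) 1ℤ (+ k)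
Jet-^ zero    = jet [] λ x _ → lemma (+ x)
  where
  lemma : ∀ t → 1ℤ ≡ 1ℤ + 0ℤ * (t - 1ℤ) + (t - 1ℤ) * (t - 1ℤ) * 0ℤ
  lemma = solve-∀
Jet-^ (suc k) = Jet-coeff refl (cong +_ (ℕₚ.+-comm k 1)) (Jet-x* (Jet-^ k))

suc-1 : ∀ y → + suc y - 1ℤ ≡ + y
suc-1 y = lemma (+ y)
  where
  lemma : ∀ y → 1ℤ + y - 1ℤ ≡ y
  lemma = solve-∀

-- At x = 2 + |a| the relation a (x − 1) ≡ 0 mod (x − 1)² makes 1 + |a| divide a.
Jet-unique : ∀ {T a} → Jet T 0ℤ a → Jet T 0ℤ 0ℤ → a ≡ 0ℤ
Jet-unique {T} {a} (jet q h) (jet q′ h′) with ℤ.∣ a ∣ ℕ.≟ 0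
... | yes ∣a∣≡0 = ℤₚ.∣i∣≡0⇒i≡0 ∣a∣≡0
... | no ∣a∣≢0 = contradiction
  (ℕ∣.divides ℤ.∣ e ∣ (trans (cong ℤ.∣_∣ a≡) (ℤₚ.abs-* e (+ suc k))))
  (ℕ∣.>⇒∤ {{ℕ.≢-nonZero ∣a∣≢0}} (ℕₚ.n<1+n k))
  where
  k = ℤ.∣ a ∣
  x = suc (suc k)
  y = eval q (+ x)
  y′ = eval q′ (+ x)
  e = y′ - y
  m = + suc k
  m≡ : + x - 1ℤ ≡ m
  m≡ = suc-1 (suc k)
  eq₁ : 0ℤ + a * m + m * m * y ≡ 0ℤ + 0ℤ * m + m * m * y′
  eq₁ = subst (λ m → 0ℤ + a * m + m * m * y ≡ 0ℤ + 0ℤ * m + m * m * y′) m≡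
          (trans (sym (h x zero)) (h′ x zero))
  lemma₁ : ∀ a m y → m * a ≡ (0ℤ + a * m + m * m * y) - m * m * y
  lemma₁ = solve-∀
  lemma₂ : ∀ m y y′ → (0ℤ + 0ℤ * m + m * m * y′) - m * m * y ≡ m * ((y′ - y) * m)
  lemma₂ = solve-∀
  a≡ : a ≡ e * m
  a≡ = ℤₚ.*-cancelˡ-≡ m a (e * m)
    (trans (lemma₁ a m y) (trans (cong (_- m * m * y) eq₁) (lemma₂ m y y′)))

SqDivides⇒Jet : ∀ {f} → SqDivides f → Jet (λ x _ → + f x) 0ℤ 0ℤ
SqDivides⇒Jet {f} (q , h) = jet q eq
  where
  lemma : ∀ m y → m * m * y ≡ 0ℤ + 0ℤ * m + m * m * y
  lemma = solve-∀
  eq : ∀ x (c : Fin x) → + f x ≡ _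
  eq x@(suc _) _ = trans (h x (s≤s z≤n)) (lemma (+ x - 1ℤ) (eval q (+ x)))

Jet⇒SqDivides : ∀ {f} → Jet (λ x _ → + f x) 0ℤ 0ℤ → SqDivides f
Jet⇒SqDivides {f} (jet q h) = q , eq
  where
  lemma : ∀ m y → 0ℤ + 0ℤ * m + m * m * y ≡ m * m * y
  lemma = solve-∀
  eq : ∀ x → 1 ≤ x → + f x ≡ _
  eq x@(suc _) _ = trans (h x zero) (lemma (+ x - 1ℤ) (eval q (+ x)))

sum-const : ∀ x a → sum {x} (λ _ → a) ≡ + x * a
sum-const zero    a = sym (ℤₚ.*-zeroˡ a)
sum-const (suc x) a = trans (cong (_+_ a) (sum-const x a)) (lemma (+ x) a)
  where
  lemma : ∀ x a → a + x * a ≡ (1ℤ + x) * a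
  lemma = solve-∀

-- The expansion does not involve c, so summing over the x colours is multiplication by x. By
-- `Jet-x*` this adds the constant term to the linear coefficient, and that term is 0.
Jet-sum : ∀ {T a} → Jet T 0ℤ a → Jet (λ x _ → sum (T x)) 0ℤ a
Jet-sum {T} {a} (jet q h) = Jet-cong {T = λ x c → + x * value x} eq
  (Jet-coeff refl (ℤₚ.+-identityʳ a) (Jet-x* {b = 0ℤ} {a} (jet q λ x c → refl)))
  where
  value : ℕ → ℤ
  value x = 0ℤ + a * (+ x - 1ℤ) + (+ x - 1ℤ) * (+ x - 1ℤ) * eval q (+ x)
  eq : ∀ x (c : Fin x) → sum (T x) ≡ + x * value x
  eq x _ = trans (sum-cong-≗ (h x)) (sum-const x (value x))

-- Indicators of decidable propositions.

⟦_⟧ : ∀ {p} {A : Set p} → Dec A → ℤ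
⟦ d ⟧ = if does d then 1ℤ else 0ℤ

module _ {p q} {A : Set p} {B : Set q} where

  ⟦⟧-⇔ : (A → B) → (B → A) → (a? : Dec A) (b? : Dec B) → ⟦ a? ⟧ ≡ ⟦ b? ⟧
  ⟦⟧-⇔ f g a? b? = cong (if_then 1ℤ else 0ℤ) (does-⇔ (mk⇔ f g) a? b?)

  ⟦⟧-× : (a? : Dec A) (b? : Dec B) → ⟦ a? ×-dec b? ⟧ ≡ ⟦ a? ⟧ * ⟦ b? ⟧
  ⟦⟧-× (yes _) (yes _) = refl
  ⟦⟧-× (yes _) (no _)  = refl
  ⟦⟧-× (no _)  b?      = sym (ℤₚ.*-zeroˡ ⟦ b? ⟧)

module _ {p} {A : Set p} where

  ⟦⟧-yes : (a? : Dec A) → A → ⟦ a? ⟧ ≡ 1ℤ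
  ⟦⟧-yes a? a = cong (if_then 1ℤ else 0ℤ) (dec-true a? a)

  ⟦⟧-no : (a? : Dec A) → ¬ A → ⟦ a? ⟧ ≡ 0ℤ
  ⟦⟧-no a? ¬a = cong (if_then 1ℤ else 0ℤ) (dec-false a? ¬a)

  ⟦⟧-¬ : (a? : Dec A) → ⟦ ¬? a? ⟧ ≡ 1ℤ - ⟦ a? ⟧
  ⟦⟧-¬ (yes _) = refl
  ⟦⟧-¬ (no _)  = refl

  ⟦⟧*-cong : (a? : Dec A) {y z : ℤ} → (A → y ≡ z) → ⟦ a? ⟧ * y ≡ ⟦ a? ⟧ * z
  ⟦⟧*-cong (yes a) eq = cong (1ℤ *_) (eq a)
  ⟦⟧*-cong (no _) {y} {z} _ = trans (ℤₚ.*-zeroˡ y) (sym (ℤₚ.*-zeroˡ z))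

sum-⟦≟⟧ : ∀ {x} (c : Fin x) (g : Fin x → ℤ) → sum (λ d → ⟦ d ≟ c ⟧ * g d) ≡ g c
sum-⟦≟⟧ {suc x} zero g = begin
  1ℤ * g zero + sum {x} (λ d → 0ℤ * g (suc d))
    ≡⟨ cong₂ _+_ (ℤₚ.*-identityˡ (g zero)) (sum-cong-≗ (λ d → ℤₚ.*-zeroˡ (g (suc d)))) ⟩
  g zero + sum {x} (λ _ → 0ℤ)
    ≡⟨ cong (_+_ (g zero)) (trans (sum-const x 0ℤ) (ℤₚ.*-zeroʳ (+ x))) ⟩
  g zero + 0ℤ
    ≡⟨ ℤₚ.+-identityʳ _ ⟩
  g zero ∎
sum-⟦≟⟧ {suc x} (suc c) g = begin
  0ℤ * g zero + sum (λ d → ⟦ suc d ≟ suc c ⟧ * g (suc d))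
    ≡⟨ cong₂ _+_ (ℤₚ.*-zeroˡ (g zero)) (sum-cong-≗ (λ d →
         cong (_* g (suc d)) (⟦⟧-⇔ suc-injective (cong suc) (suc d ≟ suc c) (d ≟ c)))) ⟩
  0ℤ + sum (λ d → ⟦ d ≟ c ⟧ * g (suc d))
    ≡⟨ trans (ℤₚ.+-identityˡ _) (sum-⟦≟⟧ c (g ∘ suc)) ⟩
  g (suc c) ∎

-- Sums over all colourings.

S : ∀ n x → ((Fin n → Fin x) → ℤ) → ℤ
S zero    x h = h (λ ())
S (suc n) x h = sum (λ c → S n x (h ∘ consF c))

S-cong : ∀ n x {g h : (Fin n → Fin x) → ℤ} → (∀ φ → g φ ≡ h φ) → S n x g ≡ S n x h
S-cong zero    x eq = eq _
S-cong (suc n) x eq = sum-cong-≗ (λ c → S-cong n x (eq ∘ consF c))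

S-+ : ∀ n x (g h : (Fin n → Fin x) → ℤ) → S n x (λ φ → g φ + h φ) ≡ S n x g + S n x h
S-+ zero    x g h = refl
S-+ (suc n) x g h = trans (sum-cong-≗ (λ c → S-+ n x (g ∘ consF c) (h ∘ consF c))) (∑-distrib-+ (λ c → S n x (g ∘ consF c)) (λ c → S n x (h ∘ consF c)))

S-*ˡ : ∀ n x a (h : (Fin n → Fin x) → ℤ) → S n x (λ φ → a * h φ) ≡ a * S n x h
S-*ˡ zero    x a h = refl
S-*ˡ (suc n) x a h = trans (sum-cong-≗ (λ c → S-*ˡ n x a (h ∘ consF c))) (sym (*-distribˡ-sum a (λ c → S n x (h ∘ consF c))))

S-- : ∀ n x (g h : (Fin n → Fin x) → ℤ) → S n x (λ φ → g φ - h φ) ≡ S n x g - S n x h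
S-- n x g h = begin
  S n x (λ φ → g φ - h φ)              ≡⟨ S-+ n x g (-_ ∘ h) ⟩
  S n x g + S n x (λ φ → - h φ)        ≡⟨ cong (_+_ (S n x g)) (S-cong n x (λ φ → sym (ℤₚ.-1*i≡-i (h φ)))) ⟩
  S n x g + S n x (λ φ → ℤ.-1ℤ * h φ)  ≡⟨ cong (_+_ (S n x g)) (S-*ˡ n x ℤ.-1ℤ h) ⟩
  S n x g + ℤ.-1ℤ * S n x h            ≡⟨ cong (_+_ (S n x g)) (ℤₚ.-1*i≡-i _) ⟩
  S n x g - S n x h                    ∎

sum-- : ∀ {k} (f g : Fin k → ℤ) → sum (λ i → f i - g i) ≡ sum f - sum g
sum-- {zero}  f g = refl
sum-- {suc k} f g = trans (cong (_+_ (f zero - g zero)) (sum-- (f ∘ suc) (g ∘ suc)))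
  (lemma (f zero) (g zero) (sum (f ∘ suc)) (sum (g ∘ suc)))
  where
  lemma : ∀ a b c d → a - b + (c - d) ≡ a + c - (b + d)
  lemma = solve-∀

sum-S-comm : ∀ n x {k} (h : Fin k → (Fin n → Fin x) → ℤ) →
  sum (λ c → S n x (h c)) ≡ S n x (λ φ → sum (λ c → h c φ))
sum-S-comm zero    x h = refl
sum-S-comm (suc n) x h = trans
  (∑-comm (λ c d → S n x (h c ∘ consF d)))
  (sum-cong-≗ (λ d → sum-S-comm n x (λ c → h c ∘ consF d)))

module _ {a p} {A : Set a} {Q : Pred A p} (Q? : Decidable Q) where

  length-filter-concatMap : ∀ {k x} (f : Fin k → Fin x) (g : Fin x → List A) →
    + length (filter Q? (concatMap g (List.tabulate f))) ≡ sum (λ i → + length (filter Q? (g (f i))))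
  length-filter-concatMap {zero}  f g = refl
  length-filter-concatMap {suc k} f g = begin
    + length (filter Q? (g (f zero) ++ concatMap g (List.tabulate (f ∘ suc))))
      ≡⟨ cong (+_ ∘ length) (Listₚ.filter-++ Q? (g (f zero)) _) ⟩
    + length (filter Q? (g (f zero)) ++ filter Q? (concatMap g (List.tabulate (f ∘ suc))))
      ≡⟨ cong +_ (Listₚ.length-++ (filter Q? (g (f zero)))) ⟩
    + length (filter Q? (g (f zero))) + + length (filter Q? (concatMap g (List.tabulate (f ∘ suc))))
      ≡⟨ cong (_+_ (+ length (filter Q? (g (f zero))))) (length-filter-concatMap (f ∘ suc) g) ⟩
    _ ∎

  length-filter-map : ∀ {b} {B : Set b} (f : B → A) (xs : List B) →
    length (filter Q? (map f xs)) ≡ length (filter (Q? ∘ f) xs)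
  length-filter-map f [] = refl
  length-filter-map f (y ∷ ys) with does (Q? (f y))
  ... | true  = cong suc (length-filter-map f ys)
  ... | false = length-filter-map f ys

-- Maps rebuilt with `consF` or through `contractMap` agree with the intended ones only pointwise,
-- so every summand must respect pointwise equality.
Extensional : ∀ {n x} {A : Set} → ((Fin n → Fin x) → A) → Set
Extensional h = ∀ {φ ψ} → φ ≗ ψ → h φ ≡ h ψ

consF-cong : ∀ {n x} (c : Fin x) {φ ψ : Fin n → Fin x} → φ ≗ ψ → consF c φ ≗ consF c ψ
consF-cong c eq zero    = refl
consF-cong c eq (suc v) = eq v

length-filter-allMaps : ∀ n x {p} {Q : Pred (Fin n → Fin x) p} (Q? : Decidable Q) →
  Extensional (λ φ → ⟦ Q? φ ⟧) →
  + length (filter Q? (allMaps n x)) ≡ S n x (λ φ → ⟦ Q? φ ⟧)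
length-filter-allMaps zero x Q? ext = trans (singleton _) (ext (λ ()))
  where
  singleton : ∀ φ → + length (filter Q? (φ ∷ [])) ≡ ⟦ Q? φ ⟧
  singleton φ with does (Q? φ)
  ... | true  = refl
  ... | false = refl
length-filter-allMaps (suc n) x Q? ext = begin
  + length (filter Q? (concatMap (λ c → map (consF c) (allMaps n x)) (allFin x)))
    ≡⟨ length-filter-concatMap Q? id (λ c → map (consF c) (allMaps n x)) ⟩
  sum (λ c → + length (filter Q? (map (consF c) (allMaps n x))))
    ≡⟨ sum-cong-≗ (λ c → trans (cong +_ (length-filter-map Q? (consF c) (allMaps n x)))
                               (length-filter-allMaps n x (Q? ∘ consF c) (ext ∘ consF-cong c))) ⟩
  sum (λ c → S n x (λ φ → ⟦ Q? (consF c φ) ⟧)) ∎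

module _ {n m x : ℕ} (E : Hypergraph n m) where

  Proper-resp-≗ : {φ ψ : Fin n → Fin x} → φ ≗ ψ → Proper E φ → Proper E ψ
  Proper-resp-≗ eq pr i with pr i
  ... | u , v , u∈ , v∈ , φu≢φv =
    u , v , u∈ , v∈ , λ ψu≡ψv → φu≢φv (trans (eq u) (trans ψu≡ψv (sym (eq v))))

  proper-ext : Extensional {n} {x} (λ φ → ⟦ proper? E φ ⟧)
  proper-ext eq = ⟦⟧-⇔ (Proper-resp-≗ eq) (Proper-resp-≗ (sym ∘ eq)) (proper? E _) (proper? E _)

P≡S : ∀ {n m} (E : Hypergraph n m) x → + P E x ≡ S n x (λ φ → ⟦ proper? E φ ⟧)
P≡S {n} E x = length-filter-allMaps n x (proper? E) (proper-ext E)

S-1 : ∀ n x → S n x (λ _ → 1ℤ) ≡ (+ x) ^ n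
S-1 zero    x = refl
S-1 (suc n) x = trans (sum-const x (S n x (λ _ → 1ℤ))) (cong (+ x *_) (S-1 n x))

-- Colourings constant on a vertex set, and contraction.

On : ∀ {n x} → Subset n → Fin x → (Fin n → Fin x) → Set
On U c φ = ∀ v → v ∈ U → φ v ≡ c

on? : ∀ {n x} (U : Subset n) (c : Fin x) (φ : Fin n → Fin x) → Dec (On U c φ)
on? U c φ = all? (λ v → (v ∈? U) →-dec (φ v ≟ c))

module _ {n x} (U : Subset n) (c d : Fin x) (φ : Fin n → Fin x) where

  on-inside : ⟦ on? (inside ∷ U) c (consF d φ) ⟧ ≡ ⟦ d ≟ c ⟧ * ⟦ on? U c φ ⟧
  on-inside = trans
    (⟦⟧-⇔ (λ h → h zero here , λ v v∈U → h (suc v) (there v∈U))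
          (λ { (eq , h) zero _ → eq ; (eq , h) (suc v) (there v∈U) → h v v∈U })
          (on? (inside ∷ U) c (consF d φ)) ((d ≟ c) ×-dec on? U c φ))
    (⟦⟧-× (d ≟ c) (on? U c φ))

  on-outside : ⟦ on? (outside ∷ U) c (consF d φ) ⟧ ≡ ⟦ on? U c φ ⟧
  on-outside = ⟦⟧-⇔ (λ h v v∈U → h (suc v) (there v∈U))
                    (λ { h (suc v) (there v∈U) → h v v∈U })
                    (on? (outside ∷ U) c (consF d φ)) (on? U c φ)

on-∪ : ∀ {n x} (U V : Subset n) (c : Fin x) φ →
  ⟦ on? U c φ ⟧ * ⟦ on? V c φ ⟧ ≡ ⟦ on? (U ∪ V) c φ ⟧
on-∪ U V c φ = trans (sym (⟦⟧-× (on? U c φ) (on? V c φ)))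
  (⟦⟧-⇔ to from (on? U c φ ×-dec on? V c φ) (on? (U ∪ V) c φ))
  where
  to : On U c φ × On V c φ → On (U ∪ V) c φ
  to (f , g) v v∈ with x∈p∪q⁻ U V v∈
  ... | inj₁ v∈U = f v v∈U
  ... | inj₂ v∈V = g v v∈V
  from : On (U ∪ V) c φ → On U c φ × On V c φ
  from h = (λ v v∈U → h v (x∈p∪q⁺ (inj₁ v∈U))) , (λ v v∈V → h v (x∈p∪q⁺ (inj₂ v∈V)))

-- A colouring equal to c on U is a free colouring of the vertices outside U, with c as the colour
-- of the identified vertex. Vertex by vertex, the indicator collapses the sum over a colour in U
-- and leaves the sum over any other colour untouched.
S-contract : ∀ {n x} (U : Subset n) (c : Fin x) (h : (Fin n → Fin x) → ℤ) → Extensional h →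
  S n x (λ φ → ⟦ on? U c φ ⟧ * h φ) ≡ S (keep U) x (λ ψ → h (consF c ψ ∘ contractMap U))
S-contract {x = x} [] c h ext = trans
  (cong (_* h (λ ())) (⟦⟧-yes (on? {x = x} [] c (λ ())) (λ ())))
  (trans (ℤₚ.*-identityˡ (h (λ ()))) (ext (λ ())))
S-contract {suc n} {x} (true ∷ U) c h ext = begin
  sum (λ d → S n x (λ φ → ⟦ on? (true ∷ U) c (consF d φ) ⟧ * h (consF d φ)))
    ≡⟨ sum-cong-≗ (λ d → trans
         (S-cong n x (λ φ → trans (cong (_* h (consF d φ)) (on-inside U c d φ))
                                  (ℤₚ.*-assoc ⟦ d ≟ c ⟧ ⟦ on? U c φ ⟧ (h (consF d φ)))))
         (S-*ˡ n x ⟦ d ≟ c ⟧ (λ φ → ⟦ on? U c φ ⟧ * h (consF d φ)))) ⟩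
  sum (λ d → ⟦ d ≟ c ⟧ * S n x (λ φ → ⟦ on? U c φ ⟧ * h (consF d φ)))
    ≡⟨ sum-⟦≟⟧ c (λ d → S n x (λ φ → ⟦ on? U c φ ⟧ * h (consF d φ))) ⟩
  S n x (λ φ → ⟦ on? U c φ ⟧ * h (consF c φ))
    ≡⟨ S-contract U c (h ∘ consF c) (ext ∘ consF-cong c) ⟩
  S (keep U) x (λ ψ → h (consF c (consF c ψ ∘ contractMap U)))
    ≡⟨ S-cong (keep U) x (λ ψ → ext (λ { zero → refl ; (suc v) → refl })) ⟩
  S (keep U) x (λ ψ → h (consF c ψ ∘ contractMap (true ∷ U))) ∎
S-contract {suc n} {x} (false ∷ U) c h ext = sum-cong-≗ λ d → begin
  S n x (λ φ → ⟦ on? (false ∷ U) c (consF d φ) ⟧ * h (consF d φ))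
    ≡⟨ S-cong n x (λ φ → cong (_* h (consF d φ)) (on-outside U c d φ)) ⟩
  S n x (λ φ → ⟦ on? U c φ ⟧ * h (consF d φ))
    ≡⟨ S-contract U c (h ∘ consF d) (ext ∘ consF-cong d) ⟩
  S (keep U) x (λ ψ → h (consF d (consF c ψ ∘ contractMap U)))
    ≡⟨ S-cong (keep U) x (λ ψ → ext (shift d ψ)) ⟩
  S (keep U) x (λ ψ → h (consF c (consF d ψ) ∘ contractMap (false ∷ U))) ∎
  where
  -- The kept vertex `zero` takes the slot just after w′ in the contraction, so d moves behind c.
  shift : ∀ d ψ → consF d (consF c ψ ∘ contractMap U) ≗ consF c (consF d ψ) ∘ contractMap (false ∷ U)
  shift d ψ zero = refl
  shift d ψ (suc v) with embed U v
  ... | just _  = refl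
  ... | nothing = refl

S-on : ∀ {n x} (U : Subset n) (c : Fin x) → S n x (λ φ → ⟦ on? U c φ ⟧) ≡ (+ x) ^ keep U
S-on {n} {x} U c = begin
  S n x (λ φ → ⟦ on? U c φ ⟧)       ≡⟨ S-cong n x (λ φ → sym (ℤₚ.*-identityʳ ⟦ on? U c φ ⟧)) ⟩
  S n x (λ φ → ⟦ on? U c φ ⟧ * 1ℤ)  ≡⟨ S-contract U c (λ _ → 1ℤ) (λ _ → refl) ⟩
  S (keep U) x (λ _ → 1ℤ)           ≡⟨ S-1 (keep U) x ⟩
  (+ x) ^ keep U                    ∎

∈-tabulate⁺ : ∀ {n} {p} {Q : Pred (Fin n) p} (Q? : Decidable Q) {v} → Q v → v ∈ tabulate (does ∘ Q?)
∈-tabulate⁺ Q? {v} q = lookup⇒[]= v _ (trans (lookup∘tabulate (does ∘ Q?) v) (dec-true (Q? v) q))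

∈-tabulate⁻ : ∀ {n} {p} {Q : Pred (Fin n) p} (Q? : Decidable Q) {v} → v ∈ tabulate (does ∘ Q?) → Q v
∈-tabulate⁻ Q? {v} v∈ with Q? v | trans (sym (lookup∘tabulate (does ∘ Q?) v)) ([]=⇒lookup v∈)
... | yes q | _ = q
... | no _  | ()

module _ {n m} (E : Hypergraph n m) (U : Subset n) where

  ∈-contract⁺ : ∀ {i v} → v ∈ E i → contractMap U v ∈ contract E U i
  ∈-contract⁺ {i} {v} v∈ =
    ∈-tabulate⁺ (λ u → any? (λ v → (v ∈? E i) ×-dec (contractMap U v ≟ u))) (v , v∈ , refl)

  ∈-contract⁻ : ∀ {i u} → u ∈ contract E U i → ∃ λ v → v ∈ E i × contractMap U v ≡ u
  ∈-contract⁻ {i} = ∈-tabulate⁻ (λ u → any? (λ v → (v ∈? E i) ×-dec (contractMap U v ≟ u)))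

  proper-contract : ∀ {x} (ψ : Fin (suc (keep U)) → Fin x) →
    ⟦ proper? E (ψ ∘ contractMap U) ⟧ ≡ ⟦ proper? (contract E U) ψ ⟧
  proper-contract ψ = ⟦⟧-⇔ to from (proper? E (ψ ∘ contractMap U)) (proper? (contract E U) ψ)
    where
    to : Proper E (ψ ∘ contractMap U) → Proper (contract E U) ψ
    to pr i with pr i
    ... | u , v , u∈ , v∈ , ≢ = _ , _ , ∈-contract⁺ u∈ , ∈-contract⁺ v∈ , ≢
    from : Proper (contract E U) ψ → Proper E (ψ ∘ contractMap U)
    from pr i with pr i
    ... | u , v , u∈ , v∈ , ≢ with ∈-contract⁻ u∈ | ∈-contract⁻ v∈
    ... | u′ , u′∈ , refl | v′ , v′∈ , refl = u′ , v′ , u′∈ , v′∈ , ≢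

  -- Proper colourings of the contraction correspond to the proper colourings of `E` that are
  -- constant on `U`; the outer sum runs over the colour of w′.
  sum-S-on-proper : ∀ x →
    sum (λ c → S n x (λ φ → ⟦ on? U c φ ⟧ * ⟦ proper? E φ ⟧)) ≡ + P (contract E U) x
  sum-S-on-proper x = trans
    (sum-cong-≗ (λ c → trans (S-contract U c (λ φ → ⟦ proper? E φ ⟧) (proper-ext E))
                             (S-cong (keep U) x (λ ψ → proper-contract (consF c ψ)))))
    (sym (P≡S (contract E U) x))

-- Each φ is counted exactly once, at c = φ w.
sum-S-root : ∀ {n x} (w : Fin n) (h : (Fin n → Fin x) → ℤ) →
  sum (λ c → S n x (λ φ → ⟦ φ w ≟ c ⟧ * h φ)) ≡ S n x h
sum-S-root {n} {x} w h = trans (sum-S-comm n x (λ c φ → ⟦ φ w ≟ c ⟧ * h φ)) (S-cong n x λ φ → trans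
  (sum-cong-≗ (λ c → cong (_* h φ) (⟦⟧-⇔ sym sym (φ w ≟ c) (c ≟ φ w))))
  (sum-⟦≟⟧ (φ w) (λ _ → h φ)))

-- Properness as a product over the edges.

-- The product stays unexpanded, so that inclusion-exclusion can proceed by induction, one edge at a
-- time.
Π¬ : ∀ {m} → (Fin m → ℤ) → ℤ
Π¬ {zero}  b = 1ℤ
Π¬ {suc m} b = (1ℤ - b zero) * Π¬ (b ∘ suc)

Π¬-⟦⟧ : ∀ {m} {B : Fin m → Set} (B? : ∀ i → Dec (B i)) {Q : Set} (Q? : Dec Q) →
  (Q → ∀ i → ¬ B i) → ((∀ i → ¬ B i) → Q) → Π¬ (λ i → ⟦ B? i ⟧) ≡ ⟦ Q? ⟧
Π¬-⟦⟧ {zero}  B? Q? to from = sym (⟦⟧-yes Q? (from λ ()))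
Π¬-⟦⟧ {suc m} {B} B? Q? to from = begin
  (1ℤ - ⟦ B? zero ⟧) * Π¬ (λ i → ⟦ B? (suc i) ⟧)
    ≡⟨ cong₂ _*_ (sym (⟦⟧-¬ (B? zero))) (Π¬-⟦⟧ (B? ∘ suc) rest? (λ f → f) (λ f → f)) ⟩
  ⟦ ¬? (B? zero) ⟧ * ⟦ rest? ⟧
    ≡⟨ sym (⟦⟧-× (¬? (B? zero)) rest?) ⟩
  ⟦ ¬? (B? zero) ×-dec rest? ⟧
    ≡⟨ ⟦⟧-⇔ (λ { (f , g) → from λ { zero → f ; (suc i) → g i } })
            (λ q → to q zero , λ i → to q (suc i)) (¬? (B? zero) ×-dec rest?) Q? ⟩
  ⟦ Q? ⟧ ∎
  where
  rest? : Dec (∀ i → ¬ B (suc i))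
  rest? = all? (λ i → ¬? (B? (suc i)))

Mono : ∀ {n m x} → Hypergraph n m → (Fin n → Fin x) → Fin m → Set
Mono E φ i = ∀ u v → u ∈ E i → v ∈ E i → φ u ≡ φ v

module _ {n m x} (E : Hypergraph n m) (φ : Fin n → Fin x) where

  Proper⇒¬Mono : Proper E φ → ∀ i → ¬ Mono E φ i
  Proper⇒¬Mono pr i mono with pr i
  ... | u , v , u∈ , v∈ , ≢ = ≢ (mono u v u∈ v∈)

  ¬Mono⇒Proper : (∀ i → ¬ Mono E φ i) → Proper E φ
  ¬Mono⇒Proper ¬mono i = decidable-stable
    (any? (λ u → any? (λ v → (u ∈? E i) ×-dec ((v ∈? E i) ×-dec ¬? (φ u ≟ φ v)))))
    (λ ¬∃ → ¬mono i (λ u v u∈ v∈ → decidable-stable (φ u ≟ φ v) (λ ≢ → ¬∃ (u , v , u∈ , v∈ , ≢))))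

  -- `B` is left open because monochromaticity is expressed in two ways once w is coloured: as
  -- having the colour of w when w is in every edge, and as a system of equations when the vertices
  -- are split at w.
  Π¬-proper : {B : Fin m → Set} (B? : ∀ i → Dec (B i)) →
    (∀ i → B i → Mono E φ i) → (∀ i → Mono E φ i → B i) →
    Π¬ (λ i → ⟦ B? i ⟧) ≡ ⟦ proper? E φ ⟧
  Π¬-proper B? to from = Π¬-⟦⟧ B? (proper? E φ)
    (λ pr i b → Proper⇒¬Mono pr i (to i b))
    (λ ¬b → ¬Mono⇒Proper (λ i mono → ¬b i (from i mono)))

On⇒Mono : ∀ {n m x} (E : Hypergraph n m) (φ : Fin n → Fin x) {c} i → On (E i) c φ → Mono E φ i
On⇒Mono E φ i on u v u∈ v∈ = trans (on u u∈) (sym (on v v∈))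

-- Hypergraphs with a vertex common to all edges.

-- The set `F` in a recursive form that matches the induction over edges in `Jet-star`.
⋂ : ∀ {n m} → Hypergraph n m → Subset n
⋂ {m = zero}  E = ⊤
⋂ {m = suc m} E = E zero ∩ ⋂ (E ∘ suc)

∈-⋂⁺ : ∀ {n m} (E : Hypergraph n m) {v} → (∀ i → v ∈ E i) → v ∈ ⋂ E
∈-⋂⁺ {m = zero}  E h = ∈⊤
∈-⋂⁺ {m = suc m} E h = x∈p∩q⁺ (h zero , ∈-⋂⁺ (E ∘ suc) (h ∘ suc))

∈-⋂⁻ : ∀ {n m} (E : Hypergraph n m) {v} → v ∈ ⋂ E → ∀ i → v ∈ E i
∈-⋂⁻ {m = suc m} E h zero    = proj₁ (x∈p∩q⁻ (E zero) (⋂ (E ∘ suc)) h)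
∈-⋂⁻ {m = suc m} E h (suc i) = ∈-⋂⁻ (E ∘ suc) (proj₂ (x∈p∩q⁻ (E zero) (⋂ (E ∘ suc)) h)) i

∈-F⁺ : ∀ {n m} (E : Hypergraph n m) {v} → (∀ i → v ∈ E i) → v ∈ F E
∈-F⁺ E = ∈-tabulate⁺ (λ v → all? (λ i → v ∈? E i))

∈-F⁻ : ∀ {n m} (E : Hypergraph n m) {v} → v ∈ F E → ∀ i → v ∈ E i
∈-F⁻ E = ∈-tabulate⁻ (λ v → all? (λ i → v ∈? E i))

F≡⋂ : ∀ {n m} (E : Hypergraph n m) → F E ≡ ⋂ E
F≡⋂ E = ⊆-antisym (λ v∈ → ∈-⋂⁺ E (∈-F⁻ E v∈)) (λ v∈ → ∈-F⁺ E (∈-⋂⁻ E v∈))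

∣⊤∩∁∣≡keep : ∀ {n} (U : Subset n) → ∣ ⊤ ∩ ∁ U ∣ ≡ keep U
∣⊤∩∁∣≡keep []          = refl
∣⊤∩∁∣≡keep (true ∷ U)  = ∣⊤∩∁∣≡keep U
∣⊤∩∁∣≡keep (false ∷ U) = cong suc (∣⊤∩∁∣≡keep U)

-- The vertices of G outside U are separated according to membership in e. This is the recursion
-- obeyed by the linear coefficient in `Jet-star`.
∣∩∁∪∣ : ∀ {n} (e G U : Subset n) → ∣ G ∩ ∁ U ∣ ≡ ∣ (e ∩ G) ∩ ∁ U ∣ ℕ.+ ∣ G ∩ ∁ (U ∪ e) ∣
∣∩∁∪∣ []          []          []          = refl
∣∩∁∪∣ (true ∷ e)  (true ∷ G)  (false ∷ U) = cong suc (∣∩∁∪∣ e G U)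
∣∩∁∪∣ (false ∷ e) (true ∷ G)  (false ∷ U) = trans (cong suc (∣∩∁∪∣ e G U)) (sym (ℕₚ.+-suc _ _))
∣∩∁∪∣ (true ∷ e)  (true ∷ G)  (true ∷ U)  = ∣∩∁∪∣ e G U
∣∩∁∪∣ (false ∷ e) (true ∷ G)  (true ∷ U)  = ∣∩∁∪∣ e G U
∣∩∁∪∣ (true ∷ e)  (false ∷ G) (true ∷ U)  = ∣∩∁∪∣ e G U
∣∩∁∪∣ (true ∷ e)  (false ∷ G) (false ∷ U) = ∣∩∁∪∣ e G U
∣∩∁∪∣ (false ∷ e) (false ∷ G) (true ∷ U)  = ∣∩∁∪∣ e G U
∣∩∁∪∣ (false ∷ e) (false ∷ G) (false ∷ U) = ∣∩∁∪∣ e G U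

∣p∣≡1+∣p∩∁⁅w⁆∣ : ∀ {n} (p : Subset n) {w} → w ∈ p → ∣ p ∣ ≡ suc ∣ p ∩ ∁ ⁅ w ⁆ ∣
∣p∣≡1+∣p∩∁⁅w⁆∣ (inside ∷ p) here = cong suc (cong ∣_∣ (p≡p∩∁⊥ p))
  where
  p≡p∩∁⊥ : ∀ {n} (p : Subset n) → p ≡ p ∩ ∁ ⊥
  p≡p∩∁⊥ []          = refl
  p≡p∩∁⊥ (true ∷ p)  = cong (true ∷_) (p≡p∩∁⊥ p)
  p≡p∩∁⊥ (false ∷ p) = cong (false ∷_) (p≡p∩∁⊥ p)
∣p∣≡1+∣p∩∁⁅w⁆∣ (true ∷ p)  (there w∈p) = cong suc (∣p∣≡1+∣p∩∁⁅w⁆∣ p w∈p)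
∣p∣≡1+∣p∩∁⁅w⁆∣ (false ∷ p) (there w∈p) = ∣p∣≡1+∣p∩∁⁅w⁆∣ p w∈p

-- The value at x = 1, namely Σ (-1)^|A| over all sets A of edges: the only colouring with one
-- colour makes every edge monochromatic, so the value is 0 as soon as there is an edge.
δ₀ : ℕ → ℤ
δ₀ zero    = 1ℤ
δ₀ (suc _) = 0ℤ

-- Expanding the product over A ⊆ {1,…,m} gives Σ (−1)^|A| x^(n − |U ∪ ⋃A|), whose linear
-- coefficient at x = 1 counts, for each v ∉ U, the sets A whose edges all avoid v.
Jet-star : ∀ {n m} (U : Subset n) (E : Hypergraph n m) →
  Jet (λ x c → S n x (λ φ → ⟦ on? U c φ ⟧ * Π¬ (λ i → ⟦ on? (E i) c φ ⟧)))
      (δ₀ m) (+ ∣ ⋂ E ∩ ∁ U ∣)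
Jet-star {n} {zero} U E = Jet-coeff refl (cong +_ (sym (∣⊤∩∁∣≡keep U)))
  (Jet-cong (λ x c → trans (S-cong n x (λ φ → ℤₚ.*-identityʳ ⟦ on? U c φ ⟧)) (S-on U c))
            (Jet-^ (keep U)))
-- The factor of the first edge either drops that edge or merges it into U. Both terms have constant
-- coefficient `δ₀ m`, which cancels in the difference.
Jet-star {n} {suc m} U E = Jet-coeff (ℤₚ.+-inverseʳ (δ₀ m)) count
  (Jet-cong split (Jet-- (Jet-star U (E ∘ suc)) (Jet-star (U ∪ E zero) (E ∘ suc))))
  where
  G = ⋂ (E ∘ suc)
  count : + ∣ G ∩ ∁ U ∣ - + ∣ G ∩ ∁ (U ∪ E zero) ∣ ≡ + ∣ (E zero ∩ G) ∩ ∁ U ∣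
  count = trans (cong (λ k → + k - + ∣ G ∩ ∁ (U ∪ E zero) ∣) (∣∩∁∪∣ (E zero) G U))
                (lemma (+ ∣ (E zero ∩ G) ∩ ∁ U ∣) (+ ∣ G ∩ ∁ (U ∪ E zero) ∣))
    where
    lemma : ∀ a b → a + b - b ≡ a
    lemma = solve-∀
  lemma : ∀ u e p → u * ((1ℤ - e) * p) ≡ u * p - (u * e) * p
  lemma = solve-∀
  split : ∀ x (c : Fin x) → _ ≡ _
  split x c = trans
    (S-cong n x (λ φ → let p = Π¬ (λ i → ⟦ on? (E (suc i)) c φ ⟧) in
      trans (lemma ⟦ on? U c φ ⟧ ⟦ on? (E zero) c φ ⟧ p)
            (cong (λ z → ⟦ on? U c φ ⟧ * p - z * p) (on-∪ U (E zero) c φ))))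
    (S-- n x (λ φ → ⟦ on? U c φ ⟧ * Π¬ (λ i → ⟦ on? (E (suc i)) c φ ⟧))
             (λ φ → ⟦ on? (U ∪ E zero) c φ ⟧ * Π¬ (λ i → ⟦ on? (E (suc i)) c φ ⟧)))

module _ {n m} (E : Hypergraph n (suc m)) {w : Fin n} (w∈F : w ∈ F E) where

  -- A monochromatic edge contains w and so has the colour c of w, which puts the count for fixed c
  -- into the form of `Jet-star` with U = {w}. Since there is an edge, the constant coefficient is
  -- 0, as `Jet-sum` requires.
  Jet-P-common-vertex : Jet (λ x _ → + P E x) 0ℤ (+ ∣ ⋂ E ∩ ∁ ⁅ w ⁆ ∣)
  Jet-P-common-vertex = Jet-cong
    (λ x _ → trans (P≡S E x) (trans (sym (sum-S-root w (λ φ → ⟦ proper? E φ ⟧)))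
                                    (sum-cong-≗ (λ c → S-cong n x (eq x c)))))
    (Jet-sum (Jet-star ⁅ w ⁆ E))
    where
    eq : ∀ x (c : Fin x) φ →
      ⟦ φ w ≟ c ⟧ * ⟦ proper? E φ ⟧ ≡ ⟦ on? ⁅ w ⁆ c φ ⟧ * Π¬ (λ i → ⟦ on? (E i) c φ ⟧)
    eq x c φ = trans
      (⟦⟧*-cong (φ w ≟ c) (λ { refl → sym (Π¬-proper E φ (λ i → on? (E i) c φ) (On⇒Mono E φ)
                                (λ i mono v v∈ → mono v w v∈ (∈-F⁻ E w∈F i))) }))
      (cong (_* Π¬ (λ i → ⟦ on? (E i) c φ ⟧))
            (⟦⟧-⇔ (λ { eq v v∈ → trans (cong φ (x∈⁅y⁆⇒x≡y w v∈)) eq }) (λ h → h w (x∈⁅x⁆ w))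
                  (φ w ≟ c) (on? ⁅ w ⁆ c φ)))

  ∣F∣≡ : ∣ F E ∣ ≡ suc ∣ ⋂ E ∩ ∁ ⁅ w ⁆ ∣
  ∣F∣≡ = trans (cong ∣_∣ (F≡⋂ E)) (∣p∣≡1+∣p∩∁⁅w⁆∣ (⋂ E) (subst (w ∈_) (F≡⋂ E) w∈F))

  SqDivides⇔∣F∣≡1 : SqDivides (P E) ⇔ (∣ F E ∣ ≡ 1)
  SqDivides⇔∣F∣≡1 = mk⇔
    (λ sq → trans ∣F∣≡ (cong suc (ℤₚ.+-injective (Jet-unique Jet-P-common-vertex (SqDivides⇒Jet sq)))))
    (λ ∣F∣≡1 → Jet⇒SqDivides (Jet-coeff refl
      (cong +_ (ℕₚ.suc-injective (trans (sym ∣F∣≡) ∣F∣≡1))) Jet-P-common-vertex))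

-- Counting the solutions of equations between colours.

-- A term over Fin n is an element of Fin (suc n): zero is the root, whose colour c is
-- prescribed, and suc v is the vertex v.  A list of equations between terms is a monomial.
Eqns : ℕ → Set
Eqns n = List (Fin (suc n) × Fin (suc n))

Sat : ∀ {k x} → List (Fin k × Fin k) → (Fin k → Fin x) → Set
Sat L Φ = All (λ (s , t) → Φ s ≡ Φ t) L

sat? : ∀ {k x} (L : List (Fin k × Fin k)) (Φ : Fin k → Fin x) → Dec (Sat L Φ)
sat? L Φ = All.all? (λ (s , t) → Φ s ≟ Φ t) L

sat-++ : ∀ {k x} (L M : List (Fin k × Fin k)) (Φ : Fin k → Fin x) →
  ⟦ sat? (L ++ M) Φ ⟧ ≡ ⟦ sat? L Φ ⟧ * ⟦ sat? M Φ ⟧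
sat-++ L M Φ = trans
  (⟦⟧-⇔ (Allₚ.++⁻ L) (λ (p , q) → Allₚ.++⁺ p q) (sat? (L ++ M) Φ) (sat? L Φ ×-dec sat? M Φ))
  (⟦⟧-× (sat? L Φ) (sat? M Φ))

-- The index of the first vertex after the root, which is the unknown eliminated at each stage of
-- `#Sat-power`.
pattern one = suc zero

skip-one : ∀ {n} → Fin (suc n) → Fin (suc (suc n))
skip-one = punchIn one

subst-one : ∀ {n} → Fin (suc n) → Fin (suc (suc n)) → Fin (suc n)
subst-one t zero          = zero
subst-one t one           = t
subst-one t (suc (suc v)) = suc v

subst-one-skip-one : ∀ {n} (t s : Fin (suc n)) → subst-one t (skip-one s) ≡ s
subst-one-skip-one t zero    = refl
subst-one-skip-one t (suc v) = refl

data View {n} : Fin (suc (suc n)) → Set where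
  is-one : View one
  other  : ∀ t → View (skip-one t)

view : ∀ {n} (s : Fin (suc (suc n))) → View s
view zero          = other zero
view one           = is-one
view (suc (suc v)) = other (suc v)

data Unlinked {n} : Fin (suc (suc n)) × Fin (suc (suc n)) → Set where
  trivial : Unlinked (one , one)
  others  : ∀ s t → Unlinked (skip-one s , skip-one t)

-- The dichotomy behind the elimination: either some equation ties the first vertex to another term
-- and so determines its colour, or no equation restricts that colour.
find-link : ∀ {n} (L : Eqns (suc n)) →
  (∃ λ t → ∀ {x} (Φ : Fin (suc (suc n)) → Fin x) → Sat L Φ → Φ one ≡ Φ (skip-one t)) ⊎ All Unlinked L
find-link [] = inj₂ []
find-link ((s , t) ∷ L) with view s | view t
... | is-one  | other t′ = inj₁ (t′ , λ Φ → λ { (eq ∷ _) → eq })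
... | other s′ | is-one  = inj₁ (s′ , λ Φ → λ { (eq ∷ _) → sym eq })
... | is-one  | is-one with find-link L
...   | inj₁ (t′ , h) = inj₁ (t′ , λ Φ → λ { (_ ∷ sat) → h Φ sat })
...   | inj₂ un       = inj₂ (trivial ∷ un)
find-link ((s , t) ∷ L) | other s′ | other t′ with find-link L
...   | inj₁ (t″ , h) = inj₁ (t″ , λ Φ → λ { (_ ∷ sat) → h Φ sat })
...   | inj₂ un       = inj₂ (others s′ t′ ∷ un)

substEqns : ∀ {n} → Fin (suc n) → Eqns (suc n) → Eqns n
substEqns t = map (λ (u , v) → subst-one t u , subst-one t v)

module _ {n x} (c d : Fin x) (φ : Fin n → Fin x) where

  private
    Φ : Fin (suc (suc n)) → Fin x
    Φ = consF c (consF d φ)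
    Ψ : Fin (suc n) → Fin x
    Ψ = consF c φ

  skip-one-val : ∀ t → Φ (skip-one t) ≡ Ψ t
  skip-one-val zero    = refl
  skip-one-val (suc v) = refl

  subst-one-val : ∀ t → d ≡ Ψ t → ∀ s → Φ s ≡ Ψ (subst-one t s)
  subst-one-val t eq zero          = refl
  subst-one-val t eq one           = eq
  subst-one-val t eq (suc (suc v)) = refl

  Sat-linked⁺ : ∀ t → d ≡ Ψ t → ∀ {L} → Sat L Φ → Sat (substEqns t L) Ψ
  Sat-linked⁺ t eq = Allₚ.gmap⁺ λ {(u , v)} e →
    trans (sym (subst-one-val t eq u)) (trans e (subst-one-val t eq v))

  Sat-linked⁻ : ∀ t → d ≡ Ψ t → ∀ {L} → Sat (substEqns t L) Ψ → Sat L Φ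
  Sat-linked⁻ t eq = Allₚ.gmap⁻ λ {(u , v)} e →
    trans (subst-one-val t eq u) (trans e (sym (subst-one-val t eq v)))

  -- The first vertex occurs only in trivial equations, so the root substituted for it is an
  -- arbitrary choice.
  Sat-unlinked⁺ : ∀ {L} → All Unlinked L → Sat L Φ → Sat (substEqns zero L) Ψ
  Sat-unlinked⁺ []                [] = []
  Sat-unlinked⁺ (trivial ∷ un)    (_ ∷ es) = refl ∷ Sat-unlinked⁺ un es
  Sat-unlinked⁺ (others s t ∷ un) (e ∷ es)
    rewrite subst-one-skip-one zero s | subst-one-skip-one zero t =
    trans (sym (skip-one-val s)) (trans e (skip-one-val t)) ∷ Sat-unlinked⁺ un es

  Sat-unlinked⁻ : ∀ {L} → All Unlinked L → Sat (substEqns zero L) Ψ → Sat L Φ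
  Sat-unlinked⁻ []                [] = []
  Sat-unlinked⁻ (trivial ∷ un)    (_ ∷ es) = refl ∷ Sat-unlinked⁻ un es
  Sat-unlinked⁻ (others s t ∷ un) (e ∷ es)
    rewrite subst-one-skip-one zero s | subst-one-skip-one zero t =
    trans (skip-one-val s) (trans e (sym (skip-one-val t))) ∷ Sat-unlinked⁻ un es

#Sat : ∀ {n} → Eqns n → ∀ x → Fin x → ℤ
#Sat {n} L x c = S n x (λ φ → ⟦ sat? L (consF c φ) ⟧)

-- The equations partition the terms into classes. The class of the root has colour c and every
-- other class is coloured freely, so k is the number of classes without the root. Eliminating one
-- vertex at a time, a linked vertex contributes a factor 1 and an unlinked one a factor x.
#Sat-power : ∀ {n} (L : Eqns n) → ∃ λ k → ∀ x (c : Fin x) → #Sat L x c ≡ (+ x) ^ k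
#Sat-power {zero} L = 0 , λ x c → ⟦⟧-yes (sat? L (consF c (λ ()))) (All.universal (λ { (zero , zero) → refl }) L)
#Sat-power {suc n} L with find-link L
... | inj₁ (t , link) = let k , h = #Sat-power (substEqns t L) in k , λ x c → begin
  sum (λ d → S n x (λ φ → ⟦ sat? L (consF c (consF d φ)) ⟧))
    ≡⟨ sum-cong-≗ (λ d → S-cong n x (λ φ → trans
         (⟦⟧-⇔ (λ sat → let eq = trans (link _ sat) (skip-one-val c d φ t) in
                         eq , Sat-linked⁺ c d φ t eq sat)
               (λ (eq , sat) → Sat-linked⁻ c d φ t eq sat)
               (sat? L (consF c (consF d φ)))
               ((d ≟ consF c φ t) ×-dec sat? (substEqns t L) (consF c φ)))
         (⟦⟧-× (d ≟ consF c φ t) (sat? (substEqns t L) (consF c φ))))) ⟩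
  sum (λ d → S n x (λ φ → ⟦ d ≟ consF c φ t ⟧ * ⟦ sat? (substEqns t L) (consF c φ) ⟧))
    ≡⟨ sum-S-comm n x (λ d φ → ⟦ d ≟ consF c φ t ⟧ * ⟦ sat? (substEqns t L) (consF c φ) ⟧) ⟩
  S n x (λ φ → sum (λ d → ⟦ d ≟ consF c φ t ⟧ * ⟦ sat? (substEqns t L) (consF c φ) ⟧))
    ≡⟨ S-cong n x (λ φ → sum-⟦≟⟧ (consF c φ t) (λ _ → ⟦ sat? (substEqns t L) (consF c φ) ⟧)) ⟩
  #Sat (substEqns t L) x c
    ≡⟨ h x c ⟩
  (+ x) ^ k ∎
... | inj₂ un = let k , h = #Sat-power (substEqns zero L) in suc k , λ x c → begin
  sum (λ d → S n x (λ φ → ⟦ sat? L (consF c (consF d φ)) ⟧))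
    ≡⟨ sum-cong-≗ (λ d → S-cong n x (λ φ →
         ⟦⟧-⇔ (Sat-unlinked⁺ c d φ un) (Sat-unlinked⁻ c d φ un)
              (sat? L (consF c (consF d φ))) (sat? (substEqns zero L) (consF c φ)))) ⟩
  sum {x} (λ _ → #Sat (substEqns zero L) x c)
    ≡⟨ sum-const x _ ⟩
  + x * #Sat (substEqns zero L) x c
    ≡⟨ cong (+ x *_) (h x c) ⟩
  + x * (+ x) ^ k ∎

#free : ∀ {n} → Eqns n → ℕ
#free L = proj₁ (#Sat-power L)

-- Factorisation over two complementary vertex sets.

DependsOn : ∀ {n x} → (Fin n → Set) → ((Fin n → Fin x) → ℤ) → Set
DependsOn A h = ∀ {φ ψ} → (∀ v → A v → φ v ≡ ψ v) → h φ ≡ h ψ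

consF-agree : ∀ {n x} {A : Fin (suc n) → Set} (d : Fin x) {φ ψ : Fin n → Fin x} →
  (∀ v → A (suc v) → φ v ≡ ψ v) → ∀ v → A v → consF d φ v ≡ consF d ψ v
consF-agree d eq zero    _ = refl
consF-agree d eq (suc v) a = eq v a

S-constant : ∀ {n x} (g : (Fin (suc n) → Fin x) → ℤ) (c : Fin x) →
  (∀ d φ → g (consF d φ) ≡ g (consF c φ)) → S (suc n) x g ≡ + x * S n x (g ∘ consF c)
S-constant {n} {x} g c const =
  trans (sum-cong-≗ (λ d → S-cong n x (const d))) (sum-const x (S n x (g ∘ consF c)))

-- Each sum on the right also runs over the coordinates that its summand ignores, which gives x^|A|
-- for f and x^(n - |A|) for g. The factor x^n on the left balances this without restricting
-- colourings to A or its complement. The colour c is where an ignored coordinate is frozen.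
S-product : ∀ {n x} (A : Subset n) (c : Fin x) (f g : (Fin n → Fin x) → ℤ) →
  DependsOn (_∉ A) f → DependsOn (_∈ A) g →
  (+ x) ^ n * S n x (λ φ → f φ * g φ) ≡ S n x f * S n x g
S-product [] c f g df dg = ℤₚ.*-identityˡ _
S-product {suc n} {x} (outside ∷ A) c f g df dg = begin
  + x * (+ x) ^ n * sum (λ d → S n x (λ φ → f (consF d φ) * g (consF d φ)))
    ≡⟨ cong (+ x * (+ x) ^ n *_) (sum-cong-≗ (λ d → S-cong n x (λ φ → cong (f (consF d φ) *_) (const d φ)))) ⟩
  + x * (+ x) ^ n * sum (λ d → S n x (λ φ → f (consF d φ) * g (consF c φ)))
    ≡⟨ trans (ℤₚ.*-assoc (+ x) _ _) (cong (+ x *_) (*-distribˡ-sum ((+ x) ^ n) (λ d → S n x (λ φ → f (consF d φ) * g (consF c φ))))) ⟩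
  + x * sum (λ d → (+ x) ^ n * S n x (λ φ → f (consF d φ) * g (consF c φ)))
    ≡⟨ cong (+ x *_) (sum-cong-≗ (λ d → S-product A c (f ∘ consF d) (g ∘ consF c)
         (λ eq → df (consF-agree d (λ v v∉ → eq v (v∉ ∘ there))))
         (λ eq → dg (consF-agree c (λ v v∈ → eq v (drop-there v∈)))))) ⟩
  + x * sum (λ d → S n x (f ∘ consF d) * G)
    ≡⟨ cong (+ x *_) (sym (*-distribʳ-sum G (λ d → S n x (f ∘ consF d)))) ⟩
  + x * (S (suc n) x f * G)
    ≡⟨ lemma (+ x) (S (suc n) x f) G ⟩
  S (suc n) x f * (+ x * G)
    ≡⟨ cong (S (suc n) x f *_) (sym (S-constant g c const)) ⟩
  S (suc n) x f * S (suc n) x g ∎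
  where
  G = S n x (g ∘ consF c)
  const : ∀ d φ → g (consF d φ) ≡ g (consF c φ)
  const d φ = dg λ { (suc v) _ → refl }
  lemma : ∀ a b c → a * (b * c) ≡ b * (a * c)
  lemma = solve-∀
S-product {suc n} {x} (inside ∷ A) c f g df dg = begin
  + x * (+ x) ^ n * sum (λ d → S n x (λ φ → f (consF d φ) * g (consF d φ)))
    ≡⟨ cong (+ x * (+ x) ^ n *_) (sum-cong-≗ (λ d → S-cong n x (λ φ → cong (_* g (consF d φ)) (const d φ)))) ⟩
  + x * (+ x) ^ n * sum (λ d → S n x (λ φ → f (consF c φ) * g (consF d φ)))
    ≡⟨ trans (ℤₚ.*-assoc (+ x) _ _) (cong (+ x *_) (*-distribˡ-sum ((+ x) ^ n) (λ d → S n x (λ φ → f (consF c φ) * g (consF d φ))))) ⟩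
  + x * sum (λ d → (+ x) ^ n * S n x (λ φ → f (consF c φ) * g (consF d φ)))
    ≡⟨ cong (+ x *_) (sum-cong-≗ (λ d → S-product A c (f ∘ consF c) (g ∘ consF d)
         (λ eq → df (consF-agree c (λ v v∉ → eq v (v∉ ∘ there))))
         (λ eq → dg (consF-agree d (λ v v∈ → eq v (drop-there v∈)))))) ⟩
  + x * sum (λ d → F′ * S n x (g ∘ consF d))
    ≡⟨ cong (+ x *_) (sym (*-distribˡ-sum F′ (λ d → S n x (g ∘ consF d)))) ⟩
  + x * (F′ * S (suc n) x g)
    ≡⟨ sym (ℤₚ.*-assoc (+ x) F′ (S (suc n) x g)) ⟩
  + x * F′ * S (suc n) x g
    ≡⟨ cong (_* S (suc n) x g) (sym (S-constant f c const)) ⟩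
  S (suc n) x f * S (suc n) x g ∎
  where
  F′ = S n x (f ∘ consF c)
  const : ∀ d φ → f (consF d φ) ≡ f (consF c φ)
  const d φ = df λ { zero 0∉ → contradiction here 0∉ ; (suc v) _ → refl }

-- The root lies over every A: its colour is prescribed, so comparing a vertex of A with it involves
-- only colours on A.
Over : ∀ {n} → (Fin n → Set) → Fin (suc n) → Set
Over A t = ∀ v → t ≡ suc v → A v

EqnsOver : ∀ {n} → (Fin n → Set) → Eqns n → Set
EqnsOver A = All (λ (s , t) → Over A s × Over A t)

sat-dependsOn : ∀ {n x} {A : Fin n → Set} {L : Eqns n} (c : Fin x) → EqnsOver A L →
  DependsOn A (λ φ → ⟦ sat? L (consF c φ) ⟧)
sat-dependsOn {A = A} {L} c over {φ} {ψ} eq =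
  ⟦⟧-⇔ (transfer eq over) (transfer (λ v a → sym (eq v a)) over) (sat? L (consF c φ)) (sat? L (consF c ψ))
  where
  val : ∀ {φ ψ} → (∀ v → A v → φ v ≡ ψ v) → ∀ t → Over A t → consF c φ t ≡ consF c ψ t
  val eq zero    _  = refl
  val eq (suc v) ov = eq v (ov v refl)
  transfer : ∀ {φ ψ} → (∀ v → A v → φ v ≡ ψ v) → ∀ {L} → EqnsOver A L → Sat L (consF c φ) → Sat L (consF c ψ)
  transfer eq []                     []       = []
  transfer eq ((os , ot) ∷ over)     (e ∷ es) =
    trans (sym (val eq _ os)) (trans e (val eq _ ot)) ∷ transfer eq over es

2^-injective : ∀ j k → (+ 2) ^ j ≡ (+ 2) ^ k → j ≡ k
2^-injective zero    zero    _  = refl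
2^-injective zero    (suc k) eq = contradiction (trans (ℤₚ.*-comm ((+ 2) ^ k) (+ 2)) (sym eq)) (odd ((+ 2) ^ k))
  where
  odd : ∀ a → a * + 2 ≢ 1ℤ
  odd a eq = ℕ∣.>⇒∤ (ℕₚ.n<1+n 1) (ℕ∣.divides ℤ.∣ a ∣ (trans (cong ℤ.∣_∣ (sym eq)) (ℤₚ.abs-* a (+ 2))))
2^-injective (suc j) zero    eq = sym (2^-injective zero (suc j) (sym eq))
2^-injective (suc j) (suc k) eq = cong suc (2^-injective j k (ℤₚ.*-cancelˡ-≡ (+ 2) _ _ eq))

module _ {n} (A : Subset n) {L M : Eqns n} (L-over : EqnsOver (_∉ A) L) (M-over : EqnsOver (_∈ A) M) where

  -- All counts in `S-product` are powers of x here, with exponents independent of x, so the single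
  -- value x = 2 determines how the exponents are related.
  #free-++ : n ℕ.+ #free (L ++ M) ≡ #free L ℕ.+ #free M
  #free-++ = 2^-injective _ _ (begin
    (+ 2) ^ (n ℕ.+ #free (L ++ M))
      ≡⟨ ℤₚ.^-distribˡ-+-* (+ 2) n (#free (L ++ M)) ⟩
    (+ 2) ^ n * (+ 2) ^ #free (L ++ M)
      ≡⟨ cong ((+ 2) ^ n *_) (sym (proj₂ (#Sat-power (L ++ M)) 2 zero)) ⟩
    (+ 2) ^ n * #Sat (L ++ M) 2 zero
      ≡⟨ cong ((+ 2) ^ n *_) (S-cong n 2 (λ φ → sat-++ L M (consF zero φ))) ⟩
    (+ 2) ^ n * S n 2 (λ φ → ⟦ sat? L (consF zero φ) ⟧ * ⟦ sat? M (consF zero φ) ⟧)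
      ≡⟨ S-product A zero _ _ (sat-dependsOn zero L-over) (sat-dependsOn zero M-over) ⟩
    #Sat L 2 zero * #Sat M 2 zero
      ≡⟨ cong₂ _*_ (proj₂ (#Sat-power L) 2 zero) (proj₂ (#Sat-power M) 2 zero) ⟩
    (+ 2) ^ #free L * (+ 2) ^ #free M
      ≡⟨ sym (ℤₚ.^-distribˡ-+-* (+ 2) (#free L) (#free M)) ⟩
    (+ 2) ^ (#free L ℕ.+ #free M) ∎)

Jet-#Sat : ∀ {n} (L : Eqns n) → Jet (#Sat L) 1ℤ (+ #free L)
Jet-#Sat L = Jet-cong (proj₂ (#Sat-power L)) (Jet-^ (#free L))

-- Colourings constant on neither side.

module _ {n} (A : Subset n) {R R′ : Eqns n} (R-over : EqnsOver (_∉ A) R) (R′-over : EqnsOver (_∈ A) R′) where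

  -- `L` and `M` collect the equations of the edges already selected by inclusion-exclusion, off A
  -- and in A respectively. When `D` is used up, what remains is a factor off A times a factor in A.
  weight : ∀ {m x} → Eqns n → Eqns n → (Fin m → Eqns n × Eqns n) → (Fin (suc n) → Fin x) → ℤ
  weight L M D Φ = (⟦ sat? L Φ ⟧ * (1ℤ - ⟦ sat? R Φ ⟧)) * (⟦ sat? M Φ ⟧ * (1ℤ - ⟦ sat? R′ Φ ⟧)) *
                   Π¬ (λ i → ⟦ sat? (proj₁ (D i) ++ proj₂ (D i)) Φ ⟧)

  -- Without D the weight is Σ ± x^k over four monomials, and by #free-++ the exponents
  -- satisfy k(L,M) − k(LR,M) − k(L,MR′) + k(LR,MR′) = 0.
  Jet-weight : ∀ {m} {L M : Eqns n} (D : Fin m → Eqns n × Eqns n) →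
    EqnsOver (_∉ A) L → EqnsOver (_∈ A) M →
    (∀ i → EqnsOver (_∉ A) (proj₁ (D i)) × EqnsOver (_∈ A) (proj₂ (D i))) →
    Jet (λ x c → S n x (λ φ → weight L M D (consF c φ))) 0ℤ 0ℤ
  Jet-weight {zero} {L} {M} D L-over M-over _ =
    Jet-coeff refl exponents (Jet-cong expand
      (Jet-- (Jet-- (Jet-#Sat (L ++ M)) (Jet-#Sat ((L ++ R) ++ M)))
             (Jet-- (Jet-#Sat (L ++ (M ++ R′))) (Jet-#Sat ((L ++ R) ++ (M ++ R′))))))
    where
    LR-over = Allₚ.++⁺ L-over R-over
    MR′-over = Allₚ.++⁺ M-over R′-over
    a₀ = + #free L
    a₁ = + #free (L ++ R)
    b₀ = + #free M
    b₁ = + #free (M ++ R′)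
    solve-k : ∀ {L M} → EqnsOver (_∉ A) L → EqnsOver (_∈ A) M →
      + #free (L ++ M) ≡ + #free L + + #free M - + n
    solve-k {L} {M} oL oM = trans (lemma (+ n) (+ #free (L ++ M)))
      (cong (λ k → + k - + n) (#free-++ A oL oM))
      where
      lemma : ∀ n k → k ≡ n + k - n
      lemma = solve-∀
    exponents :
      (+ #free (L ++ M) - + #free ((L ++ R) ++ M)) -
      (+ #free (L ++ (M ++ R′)) - + #free ((L ++ R) ++ (M ++ R′))) ≡ 0ℤ
    exponents = trans
      (cong₂ _-_ (cong₂ _-_ (solve-k L-over M-over) (solve-k LR-over M-over))
                 (cong₂ _-_ (solve-k L-over MR′-over) (solve-k LR-over MR′-over)))
      (lemma a₀ a₁ b₀ b₁ (+ n))
      where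
      lemma : ∀ a₀ a₁ b₀ b₁ n →
        ((a₀ + b₀ - n) - (a₁ + b₀ - n)) - ((a₀ + b₁ - n) - (a₁ + b₁ - n)) ≡ 0ℤ
      lemma = solve-∀
    expand : ∀ x (c : Fin x) → S n x (λ φ → weight L M D (consF c φ)) ≡
      (#Sat (L ++ M) x c - #Sat ((L ++ R) ++ M) x c) -
      (#Sat (L ++ (M ++ R′)) x c - #Sat ((L ++ R) ++ (M ++ R′)) x c)
    expand x c = trans (S-cong n x (λ φ → pointwise (consF c φ)))
      (trans (S-- n x _ _) (cong₂ _-_ (S-- n x _ _) (S-- n x _ _)))
      where
      lemma : ∀ l r m r′ → (l * (1ℤ - r)) * (m * (1ℤ - r′)) * 1ℤ ≡
        (l * m - (l * r) * m) - (l * (m * r′) - (l * r) * (m * r′))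
      lemma = solve-∀
      pointwise : ∀ Φ → weight L M D Φ ≡
        (⟦ sat? (L ++ M) Φ ⟧ - ⟦ sat? ((L ++ R) ++ M) Φ ⟧) -
        (⟦ sat? (L ++ (M ++ R′)) Φ ⟧ - ⟦ sat? ((L ++ R) ++ (M ++ R′)) Φ ⟧)
      pointwise Φ
        rewrite sat-++ L M Φ | sat-++ (L ++ R) M Φ | sat-++ L (M ++ R′) Φ
              | sat-++ (L ++ R) (M ++ R′) Φ | sat-++ L R Φ | sat-++ M R′ Φ
        = lemma ⟦ sat? L Φ ⟧ ⟦ sat? R Φ ⟧ ⟦ sat? M Φ ⟧ ⟦ sat? R′ Φ ⟧
  Jet-weight {suc m} {L} {M} D L-over M-over D-over =
    -- The first edge is either dropped or selected; if selected, its two halves join `L` and `M`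
    -- separately, so the two sides never mix.
    Jet-cong (λ x c → trans (S-cong n x (λ φ → pointwise (consF c φ))) (S-- n x _ _))
      (Jet-- (Jet-weight (D ∘ suc) L-over M-over (D-over ∘ suc))
             (Jet-weight (D ∘ suc) (Allₚ.++⁺ L-over (proj₁ (D-over zero)))
                                   (Allₚ.++⁺ M-over (proj₂ (D-over zero))) (D-over ∘ suc)))
    where
    L₀ = proj₁ (D zero)
    M₀ = proj₂ (D zero)
    lemma : ∀ l r m r′ l₀ m₀ p →
      (l * (1ℤ - r)) * (m * (1ℤ - r′)) * ((1ℤ - l₀ * m₀) * p) ≡
      (l * (1ℤ - r)) * (m * (1ℤ - r′)) * p - ((l * l₀) * (1ℤ - r)) * ((m * m₀) * (1ℤ - r′)) * p
    lemma = solve-∀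
    pointwise : ∀ {x} (Φ : _ → Fin x) → weight L M D Φ ≡
      weight L M (D ∘ suc) Φ - weight (L ++ L₀) (M ++ M₀) (D ∘ suc) Φ
    pointwise Φ rewrite sat-++ L₀ M₀ Φ | sat-++ L L₀ Φ | sat-++ M M₀ Φ =
      lemma ⟦ sat? L Φ ⟧ ⟦ sat? R Φ ⟧ ⟦ sat? M Φ ⟧ ⟦ sat? R′ Φ ⟧ ⟦ sat? L₀ Φ ⟧ ⟦ sat? M₀ Φ ⟧
            (Π¬ (λ i → ⟦ sat? (proj₁ (D (suc i)) ++ proj₂ (D (suc i))) Φ ⟧))

-- The split at w.

-- Comparison with one centre t replaces comparison of all pairs. With the root as centre, the
-- system can be cut along any partition of e.
star : ∀ {n} → Fin (suc n) → Subset n → Eqns n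
star {n} t e = map (λ v → suc v , t) (filter (_∈? e) (allFin n))

module _ {n} (t : Fin (suc n)) (e : Subset n) where

  All-star⁺ : ∀ {p} {Q : Pred (Fin (suc n) × Fin (suc n)) p} →
    (∀ v → v ∈ e → Q (suc v , t)) → All Q (star t e)
  All-star⁺ h = Allₚ.map⁺ (All.map (λ {v} v∈ → h v v∈) (Allₚ.all-filter (_∈? e) (allFin n)))

  All-star⁻ : ∀ {p} {Q : Pred (Fin (suc n) × Fin (suc n)) p} →
    All Q (star t e) → ∀ v → v ∈ e → Q (suc v , t)
  All-star⁻ h v v∈ = All.lookup (Allₚ.map⁻ h) (∈-filter⁺ (_∈? e) (∈-allFin v) v∈)

  star-over : ∀ {A : Fin n → Set} → Over A t → (∀ {v} → v ∈ e → A v) → EqnsOver A (star t e)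
  star-over ov h = All-star⁺ (λ { v v∈ → (λ { _ refl → h v∈ }) , ov })

module _ {n m} (E : Hypergraph n m) (nonempty : EdgesNonempty E) (edge : Fin m)
         (w : Fin n) (V₁ V₂ : Subset n) (∪≡⊤ : V₁ ∪ V₂ ≡ ⊤) (∩≡w : V₁ ∩ V₂ ≡ ⁅ w ⁆)
         (edges : ∀ i → w ∈ E i ⊎ (E i ⊆ V₁ ⊎ E i ⊆ V₂)) where

  w∈V₁∩V₂ : w ∈ V₁ × w ∈ V₂
  w∈V₁∩V₂ = x∈p∩q⁻ V₁ V₂ (subst (w ∈_) (sym ∩≡w) (x∈⁅x⁆ w))

  -- The two sides are V₂ and its complement V₁ ∖ {w}; the vertex w itself is counted with V₂.
  V₁∖w⇒∉V₂ : ∀ {v} → v ∈ V₁ → v ≢ w → v ∉ V₂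
  V₁∖w⇒∉V₂ {v} v∈V₁ v≢w v∈V₂ = v≢w (x∈⁅y⁆⇒x≡y w (subst (v ∈_) ∩≡w (x∈p∩q⁺ (v∈V₁ , v∈V₂))))

  ∈V₁⊎∈V₂ : ∀ v → v ∈ V₁ ⊎ v ∈ V₂
  ∈V₁⊎∈V₂ v = x∈p∪q⁻ V₁ V₂ (subst (v ∈_) (sym ∪≡⊤) ∈⊤)

  ∉V₂⇒∈V₁ : ∀ {v} → v ∉ V₂ → v ∈ V₁
  ∉V₂⇒∈V₁ {v} v∉V₂ with ∈V₁⊎∈V₂ v
  ... | inj₁ v∈V₁ = v∈V₁
  ... | inj₂ v∈V₂ = contradiction v∈V₂ v∉V₂

  -- "Edge i is monochromatic", given that w has the root colour, as equations
  -- off V₂ and equations in V₂.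
  record EdgeEqns (i : Fin m) : Set where
    field
      off in′  : Eqns n
      off-over : EqnsOver (_∉ V₂) off
      in-over  : EqnsOver (_∈ V₂) in′
      sound    : ∀ {x} (φ : Fin n → Fin x) → Sat (off ++ in′) (consF (φ w) φ) → Mono E φ i
      complete : ∀ {x} (φ : Fin n → Fin x) → Mono E φ i → Sat (off ++ in′) (consF (φ w) φ)

  root-over : ∀ {A : Fin n → Set} → Over A zero
  root-over _ ()

  centred : ∀ {x} (φ : Fin n → Fin x) i r → (∀ v → v ∈ E i → φ v ≡ φ r) → Mono E φ i
  centred φ i r h u v u∈ v∈ = trans (h u u∈) (sym (h v v∈))

  -- An edge through w is compared with the root, which belongs to both sides, so its equations can
  -- be divided along V₂. An edge avoiding w lies in a single side, where any of its vertices serves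
  -- as centre.
  edgeEqns : ∀ i → EdgeEqns i
  edgeEqns i with w ∈? E i | edges i
  ... | yes w∈ | _ = record
    { off      = star zero (E i ∩ ∁ V₂)
    ; in′      = star zero (E i ∩ V₂)
    ; off-over = star-over zero _ root-over (λ v∈ → x∈∁p⇒x∉p (proj₂ (x∈p∩q⁻ (E i) (∁ V₂) v∈)))
    ; in-over  = star-over zero _ root-over (λ v∈ → proj₂ (x∈p∩q⁻ (E i) V₂ v∈))
    ; sound    = λ φ sat → centred φ i w (sound φ sat)
    ; complete = λ φ mono → Allₚ.++⁺
        (All-star⁺ zero _ (λ v v∈ → mono v w (proj₁ (x∈p∩q⁻ (E i) (∁ V₂) v∈)) w∈))
        (All-star⁺ zero _ (λ v v∈ → mono v w (proj₁ (x∈p∩q⁻ (E i) V₂ v∈)) w∈))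
    }
    where
    sound : ∀ {x} (φ : Fin n → Fin x) →
      Sat (star zero (E i ∩ ∁ V₂) ++ star zero (E i ∩ V₂)) (consF (φ w) φ) →
      ∀ v → v ∈ E i → φ v ≡ φ w
    sound φ sat v v∈ with v ∈? V₂
    ... | yes v∈V₂ = All-star⁻ zero _ (Allₚ.++⁻ʳ (star zero (E i ∩ ∁ V₂)) sat) v (x∈p∩q⁺ (v∈ , v∈V₂))
    ... | no v∉V₂  = All-star⁻ zero _ (Allₚ.++⁻ˡ (star zero (E i ∩ ∁ V₂)) sat) v (x∈p∩q⁺ (v∈ , x∉p⇒x∈∁p v∉V₂))
  ... | no w∉ | inj₁ w∈ = contradiction w∈ w∉
  ... | no w∉ | inj₂ (inj₁ E⊆V₁) = let r , r∈ = nonempty i in record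
    { off      = star (suc r) (E i)
    ; in′      = []
    ; off-over = star-over (suc r) (E i) (λ { _ refl → ∉V₂ r∈ }) ∉V₂
    ; in-over  = []
    ; sound    = λ φ sat → centred φ i r (All-star⁻ (suc r) (E i) (Allₚ.++⁻ˡ (star (suc r) (E i)) sat))
    ; complete = λ φ mono → Allₚ.++⁺ (All-star⁺ (suc r) (E i) (λ v v∈ → mono v r v∈ r∈)) []
    }
    where
    ∉V₂ : ∀ {v} → v ∈ E i → v ∉ V₂
    ∉V₂ v∈ = V₁∖w⇒∉V₂ (E⊆V₁ v∈) (λ { refl → w∉ v∈ })
  ... | no w∉ | inj₂ (inj₂ E⊆V₂) = let r , r∈ = nonempty i in record
    { off      = []
    ; in′      = star (suc r) (E i)
    ; off-over = []
    ; in-over  = star-over (suc r) (E i) (λ { _ refl → E⊆V₂ r∈ }) E⊆V₂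
    ; sound    = λ φ sat → centred φ i r (All-star⁻ (suc r) (E i) sat)
    ; complete = λ φ mono → All-star⁺ (suc r) (E i) (λ v v∈ → mono v r v∈ r∈)
    }

  open EdgeEqns

  D : Fin m → Eqns n × Eqns n
  D i = off (edgeEqns i) , in′ (edgeEqns i)

  -- `R` speaks only of V₁ ∖ {w}, to stay off V₂; with `root-w` it forces the root colour on all of
  -- V₁. `R′` does the same for V₂, w included.
  R R′ root-w : Eqns n
  R      = star zero (∁ V₂)
  R′     = star zero V₂
  root-w = (suc w , zero) ∷ []

  R-over : EqnsOver (_∉ V₂) R
  R-over = star-over zero (∁ V₂) root-over x∈∁p⇒x∉p

  R′-over : EqnsOver (_∈ V₂) R′
  R′-over = star-over zero V₂ root-over id

  root-w-over : EqnsOver (_∈ V₂) root-w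
  root-w-over = ((λ { _ refl → proj₂ w∈V₁∩V₂ }) , root-over) ∷ []

  R≡on-V₁ : ∀ {x} (φ : Fin n → Fin x) → ⟦ sat? R (consF (φ w) φ) ⟧ ≡ ⟦ on? V₁ (φ w) φ ⟧
  R≡on-V₁ φ = ⟦⟧-⇔ to
    (λ on → All-star⁺ zero (∁ V₂) (λ v v∈ → on v (∉V₂⇒∈V₁ (x∈∁p⇒x∉p v∈))))
    (sat? R (consF (φ w) φ)) (on? V₁ (φ w) φ)
    where
    to : Sat R (consF (φ w) φ) → On V₁ (φ w) φ
    to sat v v∈ with v ≟ w
    ... | yes refl = refl
    ... | no v≢w   = All-star⁻ zero (∁ V₂) sat v (x∉p⇒x∈∁p (V₁∖w⇒∉V₂ v∈ v≢w))

  R′≡on-V₂ : ∀ {x} (c : Fin x) (φ : Fin n → Fin x) → ⟦ sat? R′ (consF c φ) ⟧ ≡ ⟦ on? V₂ c φ ⟧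
  R′≡on-V₂ c φ = ⟦⟧-⇔ (All-star⁻ zero V₂) (All-star⁺ zero V₂) (sat? R′ (consF c φ)) (on? V₂ c φ)

  -- A colouring equal to c on both sides is constant, which makes `edge` monochromatic. Hence the
  -- cross term in (1 - a)(1 - b) p disappears in `weight≡-rooted`.
  on-V₁-V₂-proper : ∀ {x} (c : Fin x) φ → ⟦ on? V₁ c φ ⟧ * ⟦ on? V₂ c φ ⟧ * ⟦ proper? E φ ⟧ ≡ 0ℤ
  on-V₁-V₂-proper c φ = trans
    (cong (_* ⟦ proper? E φ ⟧) (sym (⟦⟧-× (on? V₁ c φ) (on? V₂ c φ))))
    (trans (sym (⟦⟧-× (on? V₁ c φ ×-dec on? V₂ c φ) (proper? E φ)))
           (⟦⟧-no ((on? V₁ c φ ×-dec on? V₂ c φ) ×-dec proper? E φ)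
             (λ ((on₁ , on₂) , pr) → Proper⇒¬Mono E φ pr edge
               (On⇒Mono E φ edge (λ v _ → constant on₁ on₂ v)))))
    where
    constant : On V₁ c φ → On V₂ c φ → ∀ v → φ v ≡ c
    constant on₁ on₂ v with ∈V₁⊎∈V₂ v
    ... | inj₁ v∈ = on₁ v v∈
    ... | inj₂ v∈ = on₂ v v∈

  weight≡-rooted : ∀ {x} (φ : Fin n → Fin x) →
    weight V₂ R-over R′-over [] root-w D (consF (φ w) φ) ≡
    (⟦ proper? E φ ⟧ - ⟦ on? V₁ (φ w) φ ⟧ * ⟦ proper? E φ ⟧) - ⟦ on? V₂ (φ w) φ ⟧ * ⟦ proper? E φ ⟧
  weight≡-rooted φ = begin
    1ℤ * (1ℤ - ⟦ sat? R Φ ⟧) * (⟦ sat? root-w Φ ⟧ * (1ℤ - ⟦ sat? R′ Φ ⟧)) * monoFree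
      ≡⟨ cong₂ (λ r z → 1ℤ * (1ℤ - r) * (z * (1ℤ - ⟦ sat? R′ Φ ⟧)) * monoFree)
               (R≡on-V₁ φ) (⟦⟧-yes (sat? root-w Φ) (refl ∷ [])) ⟩
    1ℤ * (1ℤ - a) * (1ℤ * (1ℤ - ⟦ sat? R′ Φ ⟧)) * monoFree
      ≡⟨ cong₂ (λ r z → 1ℤ * (1ℤ - a) * (1ℤ * (1ℤ - r)) * z)
               (R′≡on-V₂ (φ w) φ)
               (Π¬-proper E φ (λ i → sat? (off (edgeEqns i) ++ in′ (edgeEqns i)) Φ)
                 (λ i → sound (edgeEqns i) φ) (λ i → complete (edgeEqns i) φ)) ⟩
    1ℤ * (1ℤ - a) * (1ℤ * (1ℤ - b)) * p
      ≡⟨ lemma a b p ⟩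
    (p - a * p) - b * p + a * b * p
      ≡⟨ cong (_+_ ((p - a * p) - b * p)) (on-V₁-V₂-proper (φ w) φ) ⟩
    (p - a * p) - b * p + 0ℤ
      ≡⟨ ℤₚ.+-identityʳ _ ⟩
    (p - a * p) - b * p ∎
    where
    Φ = consF (φ w) φ
    monoFree = Π¬ (λ i → ⟦ sat? (off (edgeEqns i) ++ in′ (edgeEqns i)) Φ ⟧)
    a = ⟦ on? V₁ (φ w) φ ⟧
    b = ⟦ on? V₂ (φ w) φ ⟧
    p = ⟦ proper? E φ ⟧
    lemma : ∀ a b p → 1ℤ * (1ℤ - a) * (1ℤ * (1ℤ - b)) * p ≡ (p - a * p) - b * p + a * b * p
    lemma = solve-∀

  -- When φ w ≠ c everything vanishes: `root-w` fails on the left, and on the right neither V₁ nor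
  -- V₂ can have colour c, since both contain w.
  weight≡ : ∀ {x} (c : Fin x) φ → weight V₂ R-over R′-over [] root-w D (consF c φ) ≡
    (⟦ φ w ≟ c ⟧ * ⟦ proper? E φ ⟧ - ⟦ on? V₁ c φ ⟧ * ⟦ proper? E φ ⟧) - ⟦ on? V₂ c φ ⟧ * ⟦ proper? E φ ⟧
  weight≡ c φ = by-root (φ w ≟ c)
    where
    p = ⟦ proper? E φ ⟧
    off-root : φ w ≢ c → ∀ {V} → w ∈ V → ⟦ on? V c φ ⟧ ≡ 0ℤ
    off-root φw≢c {V} w∈ = ⟦⟧-no (on? V c φ) (λ on → φw≢c (on w w∈))
    vanish : ∀ y {z} u q → z ≡ 0ℤ → y * (z * u) * q ≡ 0ℤ
    vanish y u q refl = lemma y u q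
      where
      lemma : ∀ y u q → y * (0ℤ * u) * q ≡ 0ℤ
      lemma = solve-∀
    vanish′ : ∀ {z a b} → z ≡ 0ℤ → a ≡ 0ℤ → b ≡ 0ℤ → (z * p - a * p) - b * p ≡ 0ℤ
    vanish′ refl refl refl = lemma p
      where
      lemma : ∀ p → (0ℤ * p - 0ℤ * p) - 0ℤ * p ≡ 0ℤ
      lemma = solve-∀
    by-root : Dec (φ w ≡ c) → weight V₂ R-over R′-over [] root-w D (consF c φ) ≡
      (⟦ φ w ≟ c ⟧ * p - ⟦ on? V₁ c φ ⟧ * p) - ⟦ on? V₂ c φ ⟧ * p
    by-root (yes refl) = trans (weight≡-rooted φ)
      (cong (λ z → (z - ⟦ on? V₁ c φ ⟧ * p) - ⟦ on? V₂ c φ ⟧ * p)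
            (sym (trans (cong (_* p) (⟦⟧-yes (φ w ≟ c) refl)) (ℤₚ.*-identityˡ p))))
    by-root (no φw≢c) = trans
      (vanish (1ℤ * (1ℤ - ⟦ sat? R (consF c φ) ⟧)) (1ℤ - ⟦ sat? R′ (consF c φ) ⟧)
              (Π¬ (λ i → ⟦ sat? (off (edgeEqns i) ++ in′ (edgeEqns i)) (consF c φ) ⟧))
              (⟦⟧-no (sat? root-w (consF c φ)) (λ { (eq ∷ _) → φw≢c eq })))
      (sym (vanish′ (⟦⟧-no (φ w ≟ c) φw≢c) (off-root φw≢c (proj₁ w∈V₁∩V₂)) (off-root φw≢c (proj₂ w∈V₁∩V₂))))

  -- Summed over the root colour, the three terms of `weight≡` become the counts for `E` and for its
  -- two contractions, while `Jet-weight` makes the total vanish to second order at x = 1.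
  Jet-P-split : Jet (λ x _ → (+ P E x - + P (contract E V₁) x) - + P (contract E V₂) x) 0ℤ 0ℤ
  Jet-P-split = Jet-cong (λ x _ → sym (total x))
    -- Inclusion-exclusion starts from the one equation that gives w the root colour.
    (Jet-sum (Jet-weight V₂ R-over R′-over D [] root-w-over
               (λ i → off-over (edgeEqns i) , in-over (edgeEqns i))))
    where
    total : ∀ x → sum (λ c → S n x (λ φ → weight V₂ R-over R′-over [] root-w D (consF c φ))) ≡
      (+ P E x - + P (contract E V₁) x) - + P (contract E V₂) x
    total x = begin
      sum (λ c → S n x (λ φ → weight V₂ R-over R′-over [] root-w D (consF c φ)))
        ≡⟨ sum-cong-≗ (λ c → trans (S-cong n x (weight≡ c))
             (trans (S-- n x _ _) (cong (_- B c) (S-- n x _ _)))) ⟩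
      sum (λ c → (T c - A c) - B c)
        ≡⟨ trans (sum-- (λ c → T c - A c) B) (cong (_- sum B) (sum-- T A)) ⟩
      (sum T - sum A) - sum B
        ≡⟨ cong₂ _-_ (cong₂ _-_ (trans (sum-S-root w (λ φ → ⟦ proper? E φ ⟧)) (sym (P≡S E x)))
                                (sum-S-on-proper E V₁ x))
                     (sum-S-on-proper E V₂ x) ⟩
      (+ P E x - + P (contract E V₁) x) - + P (contract E V₂) x ∎
      where
      T A B : Fin x → ℤ
      T c = S n x (λ φ → ⟦ φ w ≟ c ⟧ * ⟦ proper? E φ ⟧)
      A c = S n x (λ φ → ⟦ on? V₁ c φ ⟧ * ⟦ proper? E φ ⟧)
      B c = S n x (λ φ → ⟦ on? V₂ c φ ⟧ * ⟦ proper? E φ ⟧)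

  -- An edge avoiding w would lie inside V₁ or V₂. This excludes the case of two independent sides
  -- when `F E` is empty.
  independent⇒w∈F : Independent E V₁ → Independent E V₂ → w ∈ F E
  independent⇒w∈F ind₁ ind₂ = ∈-F⁺ E common
    where
    common : ∀ i → w ∈ E i
    common i with edges i
    ... | inj₁ w∈          = w∈
    ... | inj₂ (inj₁ E⊆V₁) = contradiction (i , λ {v} → E⊆V₁ {v}) ind₁
    ... | inj₂ (inj₂ E⊆V₂) = contradiction (i , λ {v} → E⊆V₂ {v}) ind₂

-- Contraction of sets containing an edge, and assembly of the theorem.

independent? : ∀ {n m} (E : Hypergraph n m) V → Dec (Independent E V)
independent? E V = ¬? (any? (λ i → E i ⊆? V))

-- An edge inside V becomes the singleton {w′}.
¬Independent⇒P-contract≡0 : ∀ {n m} (E : Hypergraph n m) V → ¬ Independent E V →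
  ∀ x → + P (contract E V) x ≡ 0ℤ
¬Independent⇒P-contract≡0 {n} E V ¬ind x
  with decidable-stable (any? (λ i → E i ⊆? V)) ¬ind
... | i , E⊆V = trans (sym (sum-S-on-proper E V x)) (trans
  (sum-cong-≗ (λ c → trans (S-cong n x (λ φ → trans
    (sym (⟦⟧-× (on? V c φ) (proper? E φ)))
    (⟦⟧-no (on? V c φ ×-dec proper? E φ)
      (λ (on , pr) → Proper⇒¬Mono E φ pr i (On⇒Mono E φ i (λ v v∈ → on v (E⊆V v∈)))))))
    (S-0 n x)))
  (trans (sum-const x 0ℤ) (ℤₚ.*-zeroʳ (+ x))))
  where
  S-0 : ∀ n x → S n x (λ _ → 0ℤ) ≡ 0ℤ
  S-0 n x = trans (S-*ˡ n x 0ℤ (λ _ → 0ℤ)) (ℤₚ.*-zeroˡ (S n x (λ _ → 0ℤ)))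

¬Independent⇒Jet-P-contract : ∀ {n m} (E : Hypergraph n m) V → ¬ Independent E V →
  Jet (λ x _ → + P (contract E V) x) 0ℤ 0ℤ
¬Independent⇒Jet-P-contract E V ¬ind =
  -- The zero function is expanded as x⁰ - x⁰.
  Jet-cong (λ x _ → ¬Independent⇒P-contract≡0 E V ¬ind x) (Jet-- (Jet-^ 0) (Jet-^ 0))

theorem4 : ∀ {n m : ℕ} (E : Hypergraph n m) →
  EdgesNonempty E → Sperner E → Connected E → 2 ≤ m →
  ((Nonempty (F E) → (SqDivides (P E) ⇔ (∣ F E ∣ ≡ 1)))
  ×
  (Empty (F E) →
    ∀ (w : Fin n) (V₁ V₂ : Subset n) →
    V₁ ⊂ ⊤ → V₂ ⊂ ⊤ → V₁ ∪ V₂ ≡ ⊤ → V₁ ∩ V₂ ≡ ⁅ w ⁆ →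
    (∀ i → w ∈ E i ⊎ (E i ⊆ V₁ ⊎ E i ⊆ V₂)) →
    (SqDivides (P E) ⇔
      ((¬ Independent E V₁ × ¬ Independent E V₂)
      ⊎ ((Independent E V₁ × ¬ Independent E V₂ × SqDivides (P (contract E V₁)))
        ⊎ (Independent E V₂ × ¬ Independent E V₁ × SqDivides (P (contract E V₂))))))))
theorem4 {n} {suc m} E nonempty _ _ _ =
  (λ (_ , w∈F) → SqDivides⇔∣F∣≡1 E w∈F) , part-ii
  where
  part-ii : Empty (F E) → ∀ (w : Fin n) (V₁ V₂ : Subset n) →
    V₁ ⊂ ⊤ → V₂ ⊂ ⊤ → V₁ ∪ V₂ ≡ ⊤ → V₁ ∩ V₂ ≡ ⁅ w ⁆ →
    (∀ i → w ∈ E i ⊎ (E i ⊆ V₁ ⊎ E i ⊆ V₂)) →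
    (SqDivides (P E) ⇔
      ((¬ Independent E V₁ × ¬ Independent E V₂)
      ⊎ ((Independent E V₁ × ¬ Independent E V₂ × SqDivides (P (contract E V₁)))
        ⊎ (Independent E V₂ × ¬ Independent E V₁ × SqDivides (P (contract E V₂))))))
  part-ii F-empty w V₁ V₂ _ _ ∪≡⊤ ∩≡w edges = mk⇔ to from
    where
    P₁ = P (contract E V₁)
    P₂ = P (contract E V₂)

    split : Jet (λ x _ → (+ P E x - + P₁ x) - + P₂ x) 0ℤ 0ℤ
    -- The index `zero` names an edge, which exists because m is positive.
    split = Jet-P-split E nonempty zero w V₁ V₂ ∪≡⊤ ∩≡w edges

    zero₁ : ¬ Independent E V₁ → Jet (λ x _ → + P₁ x) 0ℤ 0ℤ
    zero₁ = ¬Independent⇒Jet-P-contract E V₁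

    zero₂ : ¬ Independent E V₂ → Jet (λ x _ → + P₂ x) 0ℤ 0ℤ
    zero₂ = ¬Independent⇒Jet-P-contract E V₂

    -- By `split`, P(H) and P(H·V₁) + P(H·V₂) agree modulo (x - 1)², so divisibility of any two of
    -- the three polynomials gives that of the third.
    P-from : Jet (λ x _ → + P₁ x) 0ℤ 0ℤ → Jet (λ x _ → + P₂ x) 0ℤ 0ℤ → SqDivides (P E)
    P-from j₁ j₂ = Jet⇒SqDivides (Jet-cong (λ x _ → lemma (+ P E x) (+ P₁ x) (+ P₂ x)) (Jet-+ (Jet-+ split j₁) j₂))
      where
      lemma : ∀ a b c → a ≡ ((a - b) - c) + b + c
      lemma = solve-∀

    P₁-from : SqDivides (P E) → Jet (λ x _ → + P₂ x) 0ℤ 0ℤ → SqDivides P₁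
    P₁-from sq j₂ = Jet⇒SqDivides (Jet-cong (λ x _ → lemma (+ P E x) (+ P₁ x) (+ P₂ x))
      (Jet-- (Jet-- (SqDivides⇒Jet sq) split) j₂))
      where
      lemma : ∀ a b c → b ≡ (a - ((a - b) - c)) - c
      lemma = solve-∀

    P₂-from : SqDivides (P E) → Jet (λ x _ → + P₁ x) 0ℤ 0ℤ → SqDivides P₂
    P₂-from sq j₁ = Jet⇒SqDivides (Jet-cong (λ x _ → lemma (+ P E x) (+ P₁ x) (+ P₂ x))
      (Jet-- (Jet-- (SqDivides⇒Jet sq) split) j₁))
      where
      lemma : ∀ a b c → c ≡ (a - ((a - b) - c)) - b
      lemma = solve-∀

    to : SqDivides (P E) → _
    to sq with independent? E V₁ | independent? E V₂
    ... | no ¬i₁ | no ¬i₂ = inj₁ (¬i₁ , ¬i₂)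
    ... | yes i₁ | no ¬i₂ = inj₂ (inj₁ (i₁ , ¬i₂ , P₁-from sq (zero₂ ¬i₂)))
    ... | no ¬i₁ | yes i₂ = inj₂ (inj₂ (i₂ , ¬i₁ , P₂-from sq (zero₁ ¬i₁)))
    ... | yes i₁ | yes i₂ = contradiction
      (w , independent⇒w∈F E nonempty zero w V₁ V₂ ∪≡⊤ ∩≡w edges i₁ i₂) F-empty

    from : _ → SqDivides (P E)
    from (inj₁ (¬i₁ , ¬i₂))            = P-from (zero₁ ¬i₁) (zero₂ ¬i₂)
    from (inj₂ (inj₁ (_ , ¬i₂ , sq₁))) = P-from (SqDivides⇒Jet sq₁) (zero₂ ¬i₂)
    from (inj₂ (inj₂ (_ , ¬i₁ , sq₂))) = P-from (zero₁ ¬i₁) (SqDivides⇒Jet sq₂)
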